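{- (1) Every centric hexagon $\mathcal H$ of $\hat{\mathcal X}$ with center $n_0$ is of the form $\mathcal H=S\setminus H_0$ (with the induced subgraph of $\hat\Gamma$), where $S\subseteq Q$ is such that $Q(S)$ is an $\mathbb F_2$-subgeometry of $Q$ isomorphic to $Q^+(3,2)$ and $n_0\in\langle S\rangle_{\mathbb F_2}$. (2) Every centric cube $C$ of $\hat{\mathcal X}$ with center $n_0$ is of the form $C=S\setminus H_0$, where $Q(S)$ is an $\mathbb F_2$-subgeometry of $Q$ isomorphic to $Q(4,2)$ and $n_0\in\langle S\rangle_{\mathbb F_2}$. (3) Every centric dodecade $D$ of $\hat{\mathcal X}$ with center $n_0$ is of the form $D=S\setminus H_0$, where $Q(S)$ is an $\mathbb F_2$-subgeometry of $Q$ isomorphic to $Q^-(5,2)$ and $n_0\in\langle S\rangle_{\mathbb F_2}$.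
   Context: Let $q=2^n$, $V=V(6,q)$, and let $Q=Q^-(5,q)$ be the set of singular points of a non-degenerate quadratic form $f$ of Witt index $2$ on $V$, a generalized quadrangle of order $(q,q^2)$ whose lines are the totally singular lines; $\perp$ is the polarity defined by the bilinear form of $f$. Let $H_0$ be a hyperplane with $Q_0:=Q\cap H_0\cong Q(4,q)$ parabolic, and $n_0:=H_0^\perp$ (so $H_0=n_0^\perp$). $\hat{\mathcal X}$ is the geometry with points $Q\setminus Q_0$ and lines $l\setminus\{l\cap Q_0\}$ for lines $l$ of $Q$ not in $Q_0$; $\hat\Gamma$ is its collinearity graph. For $k\ge3$, a centric $2k$-configuration of $\hat{\mathcal X}$ with center $n_0$ is a set of $2k$ points $\{x_i^a: i=1,\dots,k,\ a=1,2\}$ of $Q\setminus Q_0$ such that $x_i^a,x_j^b$ are adjacent in $\hat\Gamma$ iff $i\ne j$ and $a\ne b$, and each projective line through $x_i^1,x_i^2$ passes through $n_0$; it is a centric hexagon, cube, dodecade for $k=3,4,6$. For $S\subseteq\mathrm{PG}(V)$, there is a unique smallest subfield $\mathbb F_S$ of $\mathbb F_q$ such that $S$ is contained in a projective subgeometry of $\mathrm{PG}(V)$ defined over $\mathbb F_S$ (the set of points, in some subspace, admitting coordinates in $\mathbb F_S$ with respect to a suitable basis), and among such subgeometries there is a smallest one, denoted $\langle S\rangle_{\mathbb F_S}$. For $S\subseteq Q$, $Q(S)$ is the point-line geometry with point set $S$ and lines the sets $l\cap S$, $l$ a line of $Q$ with $|l\cap S|\ge2$; $Q(S)$ is an $\mathbb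 F_2$-subgeometry if $\mathbb F_S=\mathbb F_2$. $Q^+(3,2)$, $Q(4,2)$, $Q^-(5,2)$ denote the classical generalized quadrangles of orders $(2,1)$, $(2,2)$, $(2,4)$. -}

module Defs where

open import Algebra.Bundles using (CommutativeRing)
import Algebra.Definitions as AlgebraDefinitions
import Algebra.Properties.Semiring.Sum as Sum
open import Data.Bool.Base using (Bool; true; false; _xor_; _∧_)
open import Data.Bool.Properties using (xor-∧-commutativeRing)
open import Data.Empty using (⊥-elim)
open import Data.Fin.Base using (Fin)
open import Data.Fin.Patterns using (0F; 1F; 2F; 3F; 4F; 5F)
open import Data.Nat.Base as ℕ using (ℕ)
open import Data.Product.Base using (Σ; _×_; _,_; proj₁; proj₂; ∃; ∃-syntax)
open import Data.Sum.Base using (_⊎_)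
open import Data.Vec.Functional using (Vector)
import Data.Vec.Functional.Relation.Binary.Equality.Setoid as VectorEquality
open import Function.Bundles using (Inverse; _⇔_)
open import Level using (0ℓ)
open import Relation.Binary.Bundles using (Setoid)
import Relation.Binary.Construct.On as On
open import Relation.Binary.Definitions using (_Respects_)
open import Relation.Binary.PropositionalEquality.Core as ≡ using (_≡_; _≢_)
import Relation.Binary.PropositionalEquality.Properties as ≡
import Relation.Binary.Reasoning.Setoid as SetoidReasoning
open import Relation.Nullary.Negation.Core using (¬_)
open import Relation.Unary using (Pred; _∈_; _∉_; _⊆_; _≐_; U)

record Geometry : Set₁ where
  infix 4 _I_
  field
    points : Setoid 0ℓ 0ℓ
    Line   : Set
  open Setoid points public using (_≈_) renaming (Carrier to Point)
  field
    _I_    : Point → Line → Set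
    I-resp : ∀ {l} → (λ p → p I l) Respects _≈_

  Adjacent : Point → Point → Set
  Adjacent p q = ¬ (p ≈ q) × ∃[ l ] (p I l × q I l)

-- Lines are treated as sets of points: an isomorphism is a bijection on
-- points under which the point rows of lines correspond.
record _≅_ (𝒢 ℋ : Geometry) : Set where
  private
    module G = Geometry 𝒢
    module H = Geometry ℋ
  field
    point↔ : Inverse G.points H.points
  open Inverse point↔ using (to)
  field
    line→ : ∀ l → ∃[ m ] (∀ p → (p G.I l) ⇔ (to p H.I m))
    line← : ∀ m → ∃[ l ] (∀ p → (p G.I l) ⇔ (to p H.I m))

-- The fields of the standard library carry an apartness relation; the
-- finite fields needed here are discrete.
record Field : Set₁ where
  field
    commutativeRing : CommutativeRing 0ℓ 0ℓ
  open CommutativeRing commutativeRing public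
  field
    0≉1     : ¬ (0# ≈ 1#)
    inverse : ∀ x → ¬ (x ≈ 0#) →
              AlgebraDefinitions.Invertible _≈_ 1# _*_ x

HasOrder : Field → ℕ → Set
HasOrder 𝔽 q = Inverse (Field.setoid 𝔽) (≡.setoid (Fin q))

module Projective (𝔽 : Field) where

  open Field 𝔽 using (0#; 1#; _+_; _*_; -_; _-_; _≈_; setoid; semiring;
                      inverse; 0≉1)
  private module F = Field 𝔽
  open Sum semiring using (sum; sum-cong-≋; *-distribˡ-sum)
  open VectorEquality setoid using (_≋_; ≋-refl; ≋-sym; ≋-trans)

  Scalar : Set
  Scalar = F.Carrier

  V : ℕ → Set
  V d = Vector Scalar d

  private variable
    d r : ℕ

  0ᵥ : V d
  0ᵥ _ = 0#

  infixl 6 _+ᵥ_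
  _+ᵥ_ : V d → V d → V d
  (u +ᵥ v) i = u i + v i

  infixr 7 _∙_
  _∙_ : Scalar → V d → V d
  (c ∙ v) i = c * v i

  combination : (Fin r → Scalar) → (Fin r → V d) → V d
  combination k b j = sum (λ i → k i * b i j)

  Independent : (Fin r → V d) → Set
  Independent b = ∀ k → combination k b ≋ 0ᵥ → ∀ i → k i ≈ 0#

  Span : (Fin r → V d) → Pred (V d) 0ℓ
  Span b v = ∃[ k ] v ≋ combination k b

  record Point (d : ℕ) : Set where
    constructor point
    field
      vec     : V d
      nonzero : ¬ (vec ≋ 0ᵥ)
  open Point public

  infix 4 _≈ₚ_
  _≈ₚ_ : Point d → Point d → Set
  p ≈ₚ q = ∃[ c ] (¬ (c ≈ 0#) × vec p ≋ c ∙ vec q)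

  private
    inv-nonzero : ∀ {c c′} → c′ * c ≈ 1# → ¬ (c′ ≈ 0#)
    inv-nonzero {c} c′c≈1 c′≈0 = 0≉1 (F.trans (F.sym (F.zeroˡ c))
      (F.trans (F.*-congʳ (F.sym c′≈0)) c′c≈1))

    cancel : ∀ {c c′ x y} → c′ * c ≈ 1# → x ≈ c * y → y ≈ c′ * x
    cancel {c} {c′} {x} {y} c′c≈1 x≈cy = begin
      y             ≈⟨ F.*-identityˡ y ⟨
      1# * y        ≈⟨ F.*-congʳ c′c≈1 ⟨
      (c′ * c) * y  ≈⟨ F.*-assoc c′ c y ⟩
      c′ * (c * y)  ≈⟨ F.*-congˡ x≈cy ⟨
      c′ * x        ∎
      where open SetoidReasoning setoid

  ≈ₚ-refl : {p : Point d} → p ≈ₚ p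
  ≈ₚ-refl = 1# , (λ 1≈0 → 0≉1 (F.sym 1≈0)) , λ i → F.sym (F.*-identityˡ _)

  ≈ₚ-sym : {p q : Point d} → p ≈ₚ q → q ≈ₚ p
  ≈ₚ-sym (c , c≉0 , p≋cq) with inverse c c≉0
  ... | c′ , c′c≈1 , _ =
    c′ , inv-nonzero c′c≈1 , λ i → cancel c′c≈1 (p≋cq i)

  ≈ₚ-trans : {p q s : Point d} → p ≈ₚ q → q ≈ₚ s → p ≈ₚ s
  ≈ₚ-trans (a , a≉0 , p≋aq) (b , b≉0 , q≋bs) =
    a * b ,
    (λ ab≈0 → b≉0 (F.trans (cancel (proj₁ (proj₂ (inverse a a≉0))) (F.sym ab≈0))
                           (F.zeroʳ _))) ,
    λ i → F.trans (p≋aq i) (F.trans (F.*-congˡ (q≋bs i))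
                                    (F.sym (F.*-assoc a b _)))

  pointSetoid : ℕ → Setoid 0ℓ 0ℓ
  pointSetoid d = record
    { Carrier       = Point d
    ; _≈_           = _≈ₚ_
    ; isEquivalence = record
      { refl  = λ {p} → ≈ₚ-refl {p = p}
      ; sym   = λ {p} {q} → ≈ₚ-sym {p = p} {q}
      ; trans = λ {p} {q} {s} → ≈ₚ-trans {p = p} {q} {s}
      }
    }

  Span-resp : (b : Fin r → V d) → (λ (p : Point d) → Span b (vec p)) Respects _≈ₚ_
  Span-resp b {p} {q} p≈q (k , p≋kb) with ≈ₚ-sym {p = p} {q} p≈q
  ... | c , _ , q≋cp = (λ i → c * k i) , λ j → begin
    vec q j                          ≈⟨ q≋cp j ⟩
    c * vec p j                      ≈⟨ F.*-congˡ (p≋kb j) ⟩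
    c * combination k b j            ≈⟨ *-distribˡ-sum c (λ i → k i * b i j) ⟩
    sum (λ i → c * (k i * b i j))    ≈⟨ sum-cong-≋ (λ i → F.sym (F.*-assoc c (k i) (b i j))) ⟩
    combination (λ i → c * k i) b j  ∎
    where open SetoidReasoning setoid

  record Hyperplane (d : ℕ) : Set where
    field
      coeff   : V d
      nonzero : ¬ (coeff ≋ 0ᵥ)

  ⟦_⟧ₕ : Hyperplane d → Pred (V d) 0ℓ
  ⟦ H ⟧ₕ v = sum (λ i → Hyperplane.coeff H i * v i) ≈ 0#

  polar : (V d → Scalar) → V d → V d → Scalar
  polar f u v = f (u +ᵥ v) - f u - f v

  record IsQuadraticForm (f : V d → Scalar) : Set where
    field
      cong      : ∀ {u v} → u ≋ v → f u ≈ f v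
      homogen   : ∀ c v → f (c ∙ v) ≈ (c * c) * f v
      polar-+   : ∀ u v w → polar f (u +ᵥ v) w ≈ polar f u w + polar f v w
      polar-∙   : ∀ c v w → polar f (c ∙ v) w ≈ c * polar f v w

  -- In characteristic 2 the radical of the polar form on an
  -- odd-dimensional space is never trivial, so non-degeneracy of f only
  -- demands that this radical contain no non-zero singular vector.
  NonDegenerateOn : Pred (V d) 0ℓ → (V d → Scalar) → Set
  NonDegenerateOn W f =
    ∀ v → v ∈ W → (∀ w → w ∈ W → polar f v w ≈ 0#) → f v ≈ 0# → v ≋ 0ᵥ

  NonDegenerate : (V d → Scalar) → Set
  NonDegenerate = NonDegenerateOn U

  TotallySingular : (V d → Scalar) → (Fin r → V d) → Set
  TotallySingular f b = ∀ v → v ∈ Span b → f v ≈ 0#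

  HasWittIndex : (V d → Scalar) → ℕ → Set
  HasWittIndex {d} f w = TSBasis w × (∀ r → TSBasis r → r ℕ.≤ w)
    where
    TSBasis : ℕ → Set
    TSBasis r = Σ (Fin r → V d) λ b → Independent b × TotallySingular f b

  -- n₀ = H₀^⊥ and H₀ = n₀^⊥: for a polarity either equation gives the other.
  record IsPerp (f : V d → Scalar) (n₀ : Point d) (H₀ : Hyperplane d) : Set where
    field
      H₀⊥≐n₀ : (λ v → ∀ w → w ∈ ⟦ H₀ ⟧ₕ → polar f v w ≈ 0#)
                 ≐ (λ v → ∃[ c ] v ≋ c ∙ vec n₀)
      n₀⊥≐H₀ : (λ v → polar f (vec n₀) v ≈ 0#) ≐ ⟦ H₀ ⟧ₕ

  module _ (f : V d → Scalar) where

    Singular : Pred (Point d) 0ℓ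
    Singular p = f (vec p) ≈ 0#

    record SingularLine : Set where
      field
        basis       : Fin 2 → V d
        independent : Independent basis
        singular    : TotallySingular f basis

    infix 4 _on_
    _on_ : Point d → SingularLine → Set
    p on l = Span (SingularLine.basis l) (vec p)

    on-resp : ∀ l → (_on l) Respects _≈ₚ_
    on-resp l {p} {q} = Span-resp (SingularLine.basis l) {p} {q}

    quadric : Geometry
    quadric = record
      { points = On.setoid {B = Σ (Point d) Singular} (pointSetoid d) proj₁
      ; Line   = SingularLine
      ; _I_    = λ p l → proj₁ p on l
      ; I-resp = λ {l} {p} {q} → on-resp l {proj₁ p} {proj₁ q}
      }

    -- Q(S).  A line l with |l ∩ S| ≥ 2 is determined by l ∩ S.
    induced : Pred (Point d) 0ℓ → Geometry
    induced S = record
      { points = On.setoid {B = Σ (Point d) S} (pointSetoid d) proj₁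
      ; Line   = Σ SingularLine λ l → ∃[ p ] ∃[ q ]
                   (p ∈ S × q ∈ S × p on l × q on l × ¬ (p ≈ₚ q))
      ; _I_    = λ p l → proj₁ p on proj₁ l
      ; I-resp = λ {l} {p} {q} → on-resp (proj₁ l) {proj₁ p} {proj₁ q}
      }

    module _ (H₀ : Hyperplane d) where

      Affine : Pred (Point d) 0ℓ
      Affine p = p ∈ Singular × vec p ∉ ⟦ H₀ ⟧ₕ

      -- The lines are l ∖ Q₀; two of them coincide only if the lines l do.
      X̂ : Geometry
      X̂ = record
        { points = On.setoid {B = Σ (Point d) Affine} (pointSetoid d) proj₁
        ; Line   = Σ SingularLine λ l → ¬ (∀ p → p on l → vec p ∈ ⟦ H₀ ⟧ₕ)
        ; _I_    = λ p l → proj₁ p on proj₁ l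
        ; I-resp = λ {l} {p} {q} → on-resp (proj₁ l) {proj₁ p} {proj₁ q}
        }

      record IsCentricConfiguration
        (k : ℕ) (n₀ : Point d) (X : Pred (Point d) 0ℓ) : Set where
        open Geometry X̂ using (Adjacent)
        field
          k≥3      : k ℕ.≥ 3
          x        : Fin k → Fin 2 → Geometry.Point X̂
          distinct : ∀ i j a b → proj₁ (x i a) ≈ₚ proj₁ (x j b) → i ≡ j × a ≡ b
          X≐x      : X ≐ (λ p → ∃[ i ] ∃[ a ] p ≈ₚ proj₁ (x i a))
          adjacent : ∀ i j a b → Adjacent (x i a) (x j b) ⇔ (i ≢ j × a ≢ b)
          center   : ∀ i → Span (λ a → vec (proj₁ (x i a))) (vec n₀)

  record IsSubfield (K : Pred Scalar 0ℓ) : Set where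
    field
      resp : K Respects _≈_
      0∈   : 0# ∈ K
      1∈   : 1# ∈ K
      +∈   : ∀ {x y} → x ∈ K → y ∈ K → x + y ∈ K
      *∈   : ∀ {x y} → x ∈ K → y ∈ K → x * y ∈ K
      -∈   : ∀ {x} → x ∈ K → - x ∈ K
      ⁻¹∈  : ∀ {x y} → x ∈ K → x * y ≈ 1# → y ∈ K

  -- The frame of a subgeometry; the field of definition K is supplied
  -- when passing to the set of points.
  record Frame (d : ℕ) : Set where
    field
      {rank}      : ℕ
      basis       : Fin rank → V d
      independent : Independent basis

  subgeometry : Pred Scalar 0ℓ → Frame d → Pred (Point d) 0ℓ
  subgeometry K B p =
    ∃[ k ] ∃[ c ] ((∀ i → k i ∈ K) × ¬ (c ≈ 0#) ×
                   vec p ≋ c ∙ combination k (Frame.basis B))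

  DefinedOver : Pred Scalar 0ℓ → Pred (Point d) 0ℓ → Set
  DefinedOver {d} K S = Σ (Frame d) λ B → S ⊆ subgeometry K B

  -- K = 𝔽_S
  record IsFieldOf (S : Pred (Point d) 0ℓ) (K : Pred Scalar 0ℓ) : Set₁ where
    field
      isSubfield  : IsSubfield K
      definedOver : DefinedOver K S
      least       : ∀ K′ → IsSubfield K′ → DefinedOver K′ S → K ⊆ K′

  -- subgeometry K B = ⟨S⟩_K
  record IsLeast (K : Pred Scalar 0ℓ) (S : Pred (Point d) 0ℓ) (B : Frame d) : Set where
    field
      contains : S ⊆ subgeometry K B
      least    : ∀ B′ → S ⊆ subgeometry K B′ → subgeometry K B ⊆ subgeometry K B′

  -- ⟨S⟩_K need not exist for every S (for q > 2, two points lie in several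
  -- 𝔽₂-lines but in no least one), so its existence is part of the assertion.
  _∈⟨_⟩_ : Point d → Pred (Point d) 0ℓ → Pred Scalar 0ℓ → Set
  _∈⟨_⟩_ {d} p S K = Σ (Frame d) λ B → IsLeast K S B × p ∈ subgeometry K B

  -- The prime field of 𝔽, when 𝔽 has characteristic 2.
  F₂ : Pred Scalar 0ℓ
  F₂ c = c ≈ 0# ⊎ c ≈ 1#

  record ArisesFrom (f : V d → Scalar) (H₀ : Hyperplane d) (n₀ : Point d)
                    (𝒬 : Geometry) (X : Pred (Point d) 0ℓ) : Set₁ where
    field
      S             : Pred (Point d) 0ℓ
      S-resp        : S Respects _≈ₚ_
      S⊆Q           : S ⊆ Singular f
      F₂-subgeom    : IsFieldOf S F₂
      Q[S]≅𝒬        : induced f S ≅ 𝒬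
      n₀∈⟨S⟩        : n₀ ∈⟨ S ⟩ F₂
      X≐S∖H₀        : X ≐ (λ p → p ∈ S × vec p ∉ ⟦ H₀ ⟧ₕ)

𝔽₂ : Field
𝔽₂ = record
  { commutativeRing = xor-∧-commutativeRing
  ; 0≉1     = λ ()
  ; inverse = λ { false 0≢0 → ⊥-elim (0≢0 ≡.refl)
                ; true  _   → true , ≡.refl , ≡.refl }
  }

-- The classical generalized quadrangles of orders (2,1), (2,2) and (2,4), by
-- the usual hyperbolic, parabolic and elliptic equations.
Q⁺[3,2] : Geometry
Q⁺[3,2] = Projective.quadric 𝔽₂ {4} λ x →
  (x 0F ∧ x 1F) xor (x 2F ∧ x 3F)

Q[4,2] : Geometry
Q[4,2] = Projective.quadric 𝔽₂ {5} λ x →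
  (x 0F ∧ x 0F) xor (x 1F ∧ x 2F) xor (x 3F ∧ x 4F)

Q⁻[5,2] : Geometry
Q⁻[5,2] = Projective.quadric 𝔽₂ {6} λ x →
  ((x 0F ∧ x 0F) xor (x 0F ∧ x 1F) xor (x 1F ∧ x 1F))
    xor (x 2F ∧ x 3F) xor (x 4F ∧ x 5F)

{-# OPTIONS --safe #-}
-- Let x_i¹, x_i² be the points of a centric 2m-configuration. Since n₀ lies on the line joining
-- them, n₀ = u_i + u_i′ with u_i, u_i′ vectors of x_i¹ and x_i². Put s = f(n₀), which is non-zero
-- since H₀ is non-degenerate. Expanding f(u_i + u_i′) and using the collinearity of x_i¹ with x_j²
-- shows that n₀, u₁, …, u_m have all polar products equal to s, with f(u_i) = 0. So f takes on the
-- 𝔽₂-combinations of these vectors only the values 0 and s, and f / s is there a quadratic form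
-- over 𝔽₂. Suitable 𝔽₂-combinations form a frame in which it is the standard hyperbolic, parabolic
-- or elliptic form; S is the set of singular points of the 𝔽₂-subgeometry on this frame.
-- For m = 6 there are seven vectors, but their sum is singular and orthogonal to all of them, hence
-- zero because f has Witt index 2.
-- The subgeometry is the least one containing S: for three points of S on a line over 𝔽₂, the
-- scales relating their vectors to any other frame over 𝔽₂ coincide, and by such lines all the
-- scales are connected.

module Submission where

open import Defs
open import Algebra.Bundles using (CommutativeRing)
import Algebra.Properties.Ring as RingProperties
import Algebra.Properties.Semiring.Mult as Mult
import Algebra.Properties.Semiring.Sum as Sum
import Algebra.Solver.Ring as RingSolver
open import Algebra.Solver.Ring.AlmostCommutativeRing
  using (_-Raw-AlmostCommutative⟶_; fromCommutativeRing)
open import Data.Bool.Base using (Bool; true; false; _xor_; _∧_; not)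
open import Data.Bool.Properties as Bool using (xor-∧-commutativeRing; ¬-not)
open import Data.Empty using (⊥-elim)
open import Data.Fin.Base as Fin using (Fin; zero; suc)
open import Data.Fin.Patterns using (0F; 1F; 2F; 3F; 4F; 5F)
open import Data.Fin.Permutation using (Permutation; permutation)
import Data.Fin.Properties as Fin
open import Data.Maybe.Base using (Maybe; just; nothing)
open import Data.Nat.Base using (ℕ; zero; suc; _^_)
import Data.Nat.Properties as ℕ
open import Data.Product.Base using (Σ; _×_; _,_; proj₁; proj₂; ∃-syntax; ∃₂)
open import Data.Sum.Base using (inj₁; inj₂)
open import Data.Vec.Base using (Vec; []; _∷_; lookup; tabulate)
import Data.Vec.Functional.Relation.Binary.Equality.Setoid as VectorEquality
open import Data.Vec.Properties using (lookup∘tabulate)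
open import Function.Base using (_∘_; id)
open import Function.Bundles using (Inverse; Equivalence; _⇔_; mk⇔)
open import Function.Properties.Inverse using (Inverse⇒Injection)
open import Level using (0ℓ)
open import Relation.Binary.Definitions using (Decidable)
open import Relation.Binary.PropositionalEquality as ≡ using (_≡_; _≢_)
import Relation.Binary.Reasoning.Setoid as SetoidReasoning
open import Relation.Nullary.Decidable
  using (Dec; yes; no; does; True; from-yes; from-no; map′; toWitness; via-injection;
         ¬?; _×-dec_; _→-dec_)
open import Relation.Nullary.Negation using (¬_)
open import Relation.Unary using (Pred; _∈_; _∉_; _⊆_; _≐_)

-- Cancellation in a field.

module FieldProperties (𝔽 : Field) where
  open Field 𝔽

  cancelˡ : ∀ {x y} → ¬ (x ≈ 0#) → x * y ≈ 0# → y ≈ 0#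
  cancelˡ {x} {y} x≉0 xy≈0 with inverse x x≉0
  ... | x′ , x′x≈1 , _ = begin
    y             ≈⟨ *-identityˡ y ⟨
    1# * y        ≈⟨ *-congʳ x′x≈1 ⟨
    (x′ * x) * y  ≈⟨ *-assoc x′ x y ⟩
    x′ * (x * y)  ≈⟨ *-congˡ xy≈0 ⟩
    x′ * 0#       ≈⟨ zeroʳ x′ ⟩
    0#            ∎
    where open SetoidReasoning setoid

  *-nonzero : ∀ {x y} → ¬ (x ≈ 0#) → ¬ (y ≈ 0#) → ¬ (x * y ≈ 0#)
  *-nonzero x≉0 y≉0 xy≈0 = y≉0 (cancelˡ x≉0 xy≈0)

-- Fields of order 2^n: decidable equality and the characteristic.

module FiniteField (𝔽 : Field) {N : ℕ} (order : HasOrder 𝔽 N) where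
  open Field 𝔽
  open FieldProperties 𝔽
  open Inverse order
  open Sum semiring
  open Mult semiring using (×1-homo-*) renaming (_×_ to _⋆_)
  open RingProperties ring using (+-cancelˡ)
  open SetoidReasoning setoid

  infix 4 _≟_
  _≟_ : Decidable _≈_
  _≟_ = via-injection (Inverse⇒Injection order) Fin._≟_

  private
    from-to : ∀ x → from (to x) ≈ x
    from-to x = strictlyInverseʳ x

    translation : Permutation N N
    translation = permutation (λ i → to (from i + 1#)) (λ i → to (from i - 1#))
      (λ i → shift i (- 1#) 1# (-‿inverseˡ 1#)) (λ i → shift i 1# (- 1#) (-‿inverseʳ 1#))
      where
      shift : ∀ i x y → x + y ≈ 0# → to (from (to (from i + x)) + y) ≡ i
      shift i x y x+y≈0 = inverseˡ (begin
        from (to (from i + x)) + y  ≈⟨ +-congʳ (from-to _) ⟩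
        (from i + x) + y            ≈⟨ +-assoc _ _ _ ⟩
        from i + (x + y)            ≈⟨ +-congˡ x+y≈0 ⟩
        from i + 0#                 ≈⟨ +-identityʳ _ ⟩
        from i                      ∎)

  -- Translation by 1 permutes the field, so it does not change the sum of all elements.
  order×1≈0 : N ⋆ 1# ≈ 0#
  order×1≈0 = +-cancelˡ (sum from) _ _ (begin
    sum from + N ⋆ 1#                   ≈⟨ +-congˡ (sum-replicate N) ⟨
    sum from + sum {N} (λ _ → 1#)       ≈⟨ ∑-distrib-+ from (λ _ → 1#) ⟨
    sum (λ i → from i + 1#)             ≈⟨ sum-cong-≋ (λ i → from-to (from i + 1#)) ⟨
    sum (λ i → from (to (from i + 1#))) ≈⟨ sum-permute from translation ⟨
    sum from                            ≈⟨ +-identityʳ _ ⟨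
    sum from + 0#                       ∎)

  -- The 2^n-fold multiple of 1 is the n-th power of 1 + 1, and a field has no zero divisors. For n
  -- = 0 the hypothesis contradicts 0 ≠ 1.
  2^n×1≈0⇒1+1≈0 : ∀ n → (2 ^ n) ⋆ 1# ≈ 0# → 1# + 1# ≈ 0#
  2^n×1≈0⇒1+1≈0 zero    1≈0 = ⊥-elim (0≉1 (sym (trans (sym (+-identityʳ 1#)) 1≈0)))
  2^n×1≈0⇒1+1≈0 (suc n) eq with (1# + 1#) ≟ 0#
  ... | yes 2≈0 = 2≈0
  ... | no  2≉0 = 2^n×1≈0⇒1+1≈0 n (cancelˡ 2≉0 (begin
    (1# + 1#) * ((2 ^ n) ⋆ 1#)  ≈⟨ *-congʳ (+-congˡ (+-identityʳ 1#)) ⟨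
    (2 ⋆ 1#) * ((2 ^ n) ⋆ 1#)   ≈⟨ ×1-homo-* 2 (2 ^ n) ⟨
    (2 ^ suc n) ⋆ 1#            ≈⟨ eq ⟩
    0#                          ∎))

HasCharacteristicTwo : Field → Set
HasCharacteristicTwo 𝔽 = 1# + 1# ≈ 0#
  where open Field 𝔽

-- Arithmetic in characteristic two and linear equations with 𝔽₂-coefficients.

module CharacteristicTwo (𝔽 : Field) (1+1≈0 : HasCharacteristicTwo 𝔽) where
  open Field 𝔽
  open Projective 𝔽 using (Scalar)
  open Sum semiring using (sum)
  private module B = CommutativeRing xor-∧-commutativeRing
  open Sum B.semiring using () renaming (sum to xor-sum)
  open SetoidReasoning setoid

  -- The embedding of 𝔽₂ as the prime field; it is additive because 1 + 1 vanishes.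
  ι : Bool → Scalar
  ι true  = 1#
  ι false = 0#

  -x≈x : ∀ x → - x ≈ x
  -x≈x x = begin
    - x                    ≈⟨ +-identityʳ _ ⟨
    - x + 0#               ≈⟨ +-congˡ (trans (*-congˡ 1+1≈0) (zeroʳ x)) ⟨
    - x + x * (1# + 1#)    ≈⟨ +-congˡ (trans (distribˡ x 1# 1#) (+-cong (*-identityʳ x) (*-identityʳ x))) ⟩
    - x + (x + x)          ≈⟨ +-assoc _ _ _ ⟨
    (- x + x) + x          ≈⟨ +-congʳ (-‿inverseˡ x) ⟩
    0# + x                 ≈⟨ +-identityˡ x ⟩
    x                      ∎

  ι-xor : ∀ a b → ι (a xor b) ≈ ι a + ι b
  ι-xor true  true  = sym 1+1≈0
  ι-xor true  false = sym (+-identityʳ _)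
  ι-xor false b     = sym (+-identityˡ _)

  ι-∧ : ∀ a b → ι (a ∧ b) ≈ ι a * ι b
  ι-∧ true  b = sym (*-identityˡ _)
  ι-∧ false b = sym (zeroˡ _)

  ι-injective : ∀ a b → ι a ≈ ι b → a ≡ b
  ι-injective true  true  _  = ≡.refl
  ι-injective true  false eq = ⊥-elim (0≉1 (sym eq))
  ι-injective false true  eq = ⊥-elim (0≉1 eq)
  ι-injective false false _  = ≡.refl

  ι-cong : ∀ {a b} → a ≡ b → ι a ≈ ι b
  ι-cong ≡.refl = refl

  ι-sum : ∀ {n} (k : Fin n → Bool) → ι (xor-sum k) ≈ sum (ι ∘ k)
  ι-sum {zero}  k = refl
  ι-sum {suc n} k = trans (ι-xor (k 0F) _) (+-congˡ (ι-sum (k ∘ suc)))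

  private
    morphism : B.rawRing -Raw-AlmostCommutative⟶ fromCommutativeRing commutativeRing
    morphism = record
      { ⟦_⟧    = ι
      ; +-homo = ι-xor
      ; *-homo = ι-∧
      ; -‿homo = λ a → sym (-x≈x (ι a))
      ; 0-homo = refl
      ; 1-homo = refl
      }

    ι-decide : ∀ a b → Maybe (ι a ≈ ι b)
    ι-decide true  true  = just refl
    ι-decide false false = just refl
    ι-decide _     _     = nothing

  -- Coefficients in 𝔽₂ let the solver use 1 + 1 ≈ 0.
  open RingSolver B.rawRing (fromCommutativeRing commutativeRing) morphism ι-decide public
    using (solve; _:=_; _:+_; _:*_; _:-_; con)

  x+x≈0 : ∀ x → x + x ≈ 0#
  x+x≈0 = solve 1 (λ x → x :+ x := con false) refl

  +-transpose : ∀ {x y z} → x + y ≈ z → y ≈ z + x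
  +-transpose {x} {y} {z} eq = trans
    (solve 2 (λ x y → y := x :+ y :+ x) refl x y) (+-congʳ eq)

  private
    ∃-true : ∀ {n} (a : Fin n → Bool) → ¬ (∀ j → a j ≡ false) → ∃[ j ] a j ≡ true
    ∃-true a a≢0 with Fin.¬∀⟶∃¬ _ (λ j → a j ≡ false) (λ j → a j Bool.≟ false) a≢0
    ... | j , aj≢f = j , ¬-not aj≢f

    -- In coordinate `l`, where `a` is true and `b` is false, the equation determines `α`;
    -- substituting this into coordinate `j`, where `b` is true, determines `β`.
    solve₁ : ∀ {n} (a b d : Fin n → Bool) α β γ →
      (∀ j → α * ι (a j) + β * ι (b j) ≈ γ * ι (d j)) →
      ∀ {j l} → a l ≡ true → b l ≡ false → b j ≡ true →
      ∃₂ λ α′ β′ → α ≈ γ * ι α′ × β ≈ γ * ι β′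
    solve₁ a b d α β γ eq {j} {l} al bl bj with a l | b l | b j | a j | eq l | eq j
    solve₁ a b d α β γ eq {j} {l} ≡.refl ≡.refl ≡.refl | _ | _ | _ | aj | eql | eqj =
      d l , d j xor (aj ∧ d l) , α≈ , β≈
      where
      α≈ : α ≈ γ * ι (d l)
      α≈ = trans (solve 2 (λ α β → α := α :* con true :+ β :* con false) refl α β) eql
      β≈ : β ≈ γ * ι (d j xor (aj ∧ d l))
      β≈ = begin
        β                                          ≈⟨ solve 3 (λ α β x → β := α :* x :+ β :* con true :+ α :* x) refl α β (ι aj) ⟩
        α * ι aj + β * 1# + α * ι aj               ≈⟨ +-cong eqj (*-congʳ α≈) ⟩
        γ * ι (d j) + γ * ι (d l) * ι aj           ≈⟨ solve 4 (λ g x y z → g :* x :+ g :* y :* z := g :* (x :+ z :* y)) refl γ (ι (d j)) (ι (d l)) (ι aj) ⟩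
        γ * (ι (d j) + ι aj * ι (d l))             ≈⟨ *-congˡ (trans (ι-xor (d j) _) (+-congˡ (ι-∧ aj (d l)))) ⟨
        γ * ι (d j xor (aj ∧ d l))                 ∎

  -- Two distinct non-zero vectors a, b over 𝔽₂ have a 2 × 2 minor equal to 1,
  -- so Cramer's rule yields α and β without division.
  solve-F₂ : ∀ {n} (a b d : Fin n → Bool) α β γ →
    (∀ j → α * ι (a j) + β * ι (b j) ≈ γ * ι (d j)) →
    ¬ (∀ j → a j ≡ false) → ¬ (∀ j → b j ≡ false) → ¬ (∀ j → a j ≡ b j) →
    ∃₂ λ α′ β′ → α ≈ γ * ι α′ × β ≈ γ * ι β′
  solve-F₂ {n} a b d α β γ eq a≢0 b≢0 a≢b
    with ∃-true a a≢0 | ∃-true b b≢0 | Fin.¬∀⟶∃¬ n _ (λ j → a j Bool.≟ b j) a≢b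
  ... | i , ai | j , bj | l , al≢bl with a l in al | b l in bl
  ... | true  | true  = ⊥-elim (al≢bl ≡.refl)
  ... | false | false = ⊥-elim (al≢bl ≡.refl)
  ... | true  | false = solve₁ a b d α β γ eq al bl bj
  -- Here `b` is true and `a` is false in coordinate `l`, so the two exchange roles, and coordinate
  -- `i`, where `a` is true, is the second one.
  ... | false | true  with solve₁ b a d β α γ (λ m → trans (+-comm _ _) (eq m)) bl al ai
  ...   | β′ , α′ , β≈ , α≈ = α′ , β′ , α≈ , β≈

-- Quadratic forms and their singular vectors in coordinates over 𝔽₂.

module BooleanVectors where
  private module B = CommutativeRing xor-∧-commutativeRing
  open Sum B.semiring using () renaming (sum to xor-sum) public

  private variable
    m r : ℕ

  δ : Fin r → Fin r → Bool
  δ i j = does (i Fin.≟ j)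

  infixl 7 _·_
  _·_ : (Fin r → Bool) → (Fin r → Fin m → Bool) → Fin m → Bool
  (k · E) j = xor-sum (λ i → k i ∧ E i j)

  -- The quadratic form with the terms G_ii k_i² and, for i < j, G_ij k_i k_j; only the diagonal and
  -- the upper triangle of `G` are read.
  gramForm : (Fin m → Fin m → Bool) → (Fin m → Bool) → Bool
  gramForm {zero}  G k = false
  gramForm {suc m} G k = ((k 0F ∧ G 0F 0F) xor gramForm (λ i j → G (suc i) (suc j)) (k ∘ suc))
                           xor (k 0F ∧ xor-sum (λ i → k (suc i) ∧ G 0F (suc i)))

  -- The Gram matrix of the vectors n₀, u₁, …, u_m in the header.
  configurationGram : Fin (suc m) → Fin (suc m) → Bool
  configurationGram zero    _       = true
  configurationGram (suc i) zero    = true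
  configurationGram (suc i) (suc j) = not (does (i Fin.≟ j))

  -- The points on the line through n₀ and uᵢ, in coordinates with respect to n₀, u₁, …, u_m.
  pointVector : Fin m → Fin 2 → Fin (suc m) → Bool
  pointVector i 0F = δ (suc i)
  pointVector i 1F = λ j → δ zero j xor δ (suc i) j

  polarForm : ((Fin r → Bool) → Bool) → (Fin r → Bool) → (Fin r → Bool) → Bool
  polarForm q k l = q (λ i → k i xor l i) xor (q k xor q l)

  configurationPolar : (Fin (suc m) → Bool) → (Fin (suc m) → Bool) → Bool
  configurationPolar = polarForm (gramForm configurationGram)

  -- The vectors `k`, `l` and their sum are the three points of a totally singular 𝔽₂-line: over 𝔽₂,
  -- two distinct non-zero vectors are independent.
  Collinear : ((Fin r → Bool) → Bool) → (Fin r → Bool) → (Fin r → Bool) → Set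
  Collinear q k l =
    (q k ≡ false × q l ≡ false × q (λ i → k i xor l i) ≡ false) ×
    (¬ (∀ i → k i ≡ false) × ¬ (∀ i → l i ≡ false) × ¬ (∀ i → k i ≡ l i))

  -- Vectors whose scale in any 𝔽₂-subgeometry containing all singular points is forced to be that
  -- of g: the three points of an 𝔽₂-line have a common scale.
  data Generated (q : (Fin r → Bool) → Bool) (g : Fin r → Bool) : (Fin r → Bool) → Set where
    origin : Generated q g g
    step   : ∀ {k l} → Generated q g k → Collinear q k l → Generated q g l
    add    : ∀ {k l} → Generated q g k → Generated q g l → Generated q g (λ i → k i xor l i)
    ≗-resp : ∀ {k l} → Generated q g k → (∀ i → k i ≡ l i) → Generated q g l

  -- E expresses a frame through n₀, u₁, …, u_m; ν and Y are the coordinates of n₀ and of the points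
  -- of the configuration with respect to this frame.
  record Model (m : ℕ) {r : ℕ} (q : (Fin r → Bool) → Bool) : Set where
    field
      E         : Fin r → Fin (suc m) → Bool
      gram≡q    : ∀ k → gramForm configurationGram (k · E) ≡ q k
      ν         : Fin r → Bool
      ν·E       : ∀ j → (ν · E) j ≡ δ zero j
      {g}       : Fin r → Bool
      g≢0       : ¬ (∀ i → g i ≡ false)
      qg        : q g ≡ false
      generated : ∀ i → Generated q g (δ i)
      Y         : Fin m → Fin 2 → Fin r → Bool
      cover     : ∀ k → q k ≡ false → polarForm q ν k ≡ true → ∃₂ λ i a → ∀ j → k j ≡ Y i a j

open BooleanVectors

-- Linear combinations, in particular those with coefficients in 𝔽₂.

module Combinations (𝔽 : Field) (1+1≈0 : HasCharacteristicTwo 𝔽) where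
  open Field 𝔽
  open FieldProperties 𝔽
  open CharacteristicTwo 𝔽 1+1≈0
  open Projective 𝔽
  open Sum semiring
  open SetoidReasoning setoid
  open VectorEquality setoid using (_≋_; ≋-sym; ≋-trans) public

  private variable
    d m r : ℕ

  *-cancelˡ-nonzero : ∀ {x y z} → ¬ (x ≈ 0#) → x * y ≈ x * z → y ≈ z
  *-cancelˡ-nonzero {x} {y} {z} x≉0 xy≈xz = begin
    y             ≈⟨ solve 2 (λ y z → y := y :+ z :+ z) refl y z ⟩
    (y + z) + z   ≈⟨ +-congʳ (cancelˡ x≉0 (trans (distribˡ x y z) (trans (+-congʳ xy≈xz) (x+x≈0 _)))) ⟩
    0# + z        ≈⟨ +-identityˡ z ⟩
    z             ∎

  combination-cong : {k l : Fin r → Scalar} {b b′ : Fin r → V d} → (∀ i → k i ≈ l i) →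
    (∀ i → b i ≋ b′ i) → combination k b ≋ combination l b′
  combination-cong k≈l b≈b′ j = sum-cong-≋ (λ i → *-cong (k≈l i) (b≈b′ i j))

  combination-+ : ∀ k l (b : Fin r → V d) →
    combination (λ i → k i + l i) b ≋ combination k b +ᵥ combination l b
  combination-+ k l b j =
    trans (sum-cong-≋ (λ i → distribʳ (b i j) (k i) (l i))) (∑-distrib-+ (λ i → k i * b i j) (λ i → l i * b i j))

  combination-∙ : ∀ c k (b : Fin r → V d) →
    combination (λ i → c * k i) b ≋ c ∙ combination k b
  combination-∙ c k b j =
    trans (sum-cong-≋ (λ i → *-assoc c (k i) (b i j))) (sym (*-distribˡ-sum c (λ i → k i * b i j)))

  combination-zero : ∀ {k} (b : Fin r → V d) → (∀ i → k i ≈ 0#) → combination k b ≋ 0ᵥ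
  combination-zero {r} b k≈0 j =
    trans (sum-cong-≋ (λ i → trans (*-congʳ (k≈0 i)) (zeroˡ _))) (sum-replicate-zero r)

  combination-injective : (b : Fin r → V d) → Independent b → ∀ k l →
    combination k b ≋ combination l b → ∀ i → k i ≈ l i
  combination-injective b ind k l eq i =
    sym (trans (+-transpose (ind (λ i → k i + l i) k+l≈0 i)) (+-identityˡ _))
    where
    k+l≈0 : combination (λ i → k i + l i) b ≋ 0ᵥ
    k+l≈0 j = trans (combination-+ k l b j) (trans (+-congʳ (eq j)) (x+x≈0 _))

  span-+ : ∀ (b : Fin r → V d) {u v : V d} → Span b u → Span b v → Span b (u +ᵥ v)
  span-+ b (k , u≋) (l , v≋) =
    (λ i → k i + l i) , λ j → trans (+-cong (u≋ j) (v≋ j)) (sym (combination-+ k l b j))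

  span-∙ : ∀ (b : Fin r → V d) {v : V d} c → Span b v → Span b (c ∙ v)
  span-∙ b c (k , v≋) =
    (λ i → c * k i) , λ j → trans (*-congˡ (v≋ j)) (sym (combination-∙ c k b j))

  span-cong : ∀ (b : Fin r → V d) {u v : V d} → u ≋ v → Span b u → Span b v
  span-cong b u≋v (k , u≋) = k , ≋-trans (≋-sym u≋v) u≋

  unscale : ∀ {c} {u v : V d} → ¬ (c ≈ 0#) → u ≋ c ∙ v → ∃[ c′ ] ¬ (c′ ≈ 0#) × v ≋ c′ ∙ u
  unscale {c = c} {u} {v} c≉0 u≋cv with inverse c c≉0
  ... | c′ , c′c≈1 , _ = c′
    , (λ c′≈0 → 0≉1 (trans (sym (zeroˡ c)) (trans (*-congʳ (sym c′≈0)) c′c≈1)))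
    , λ j → begin
      v j             ≈⟨ *-identityˡ _ ⟨
      1# * v j        ≈⟨ *-congʳ c′c≈1 ⟨
      (c′ * c) * v j  ≈⟨ *-assoc _ _ _ ⟩
      c′ * (c * v j)  ≈⟨ *-congˡ (u≋cv j) ⟨
      c′ * u j        ∎

  emb : (Fin r → V d) → (Fin r → Bool) → V d
  emb b k = combination (ι ∘ k) b

  emb-cong : (b : Fin r → V d) → ∀ {k l} → (∀ i → k i ≡ l i) → emb b k ≋ emb b l
  emb-cong b k≗l = combination-cong {b = b} (λ i → ι-cong (k≗l i)) (λ _ _ → refl)

  emb-xor : ∀ (b : Fin r → V d) k l → emb b (λ i → k i xor l i) ≋ emb b k +ᵥ emb b l
  emb-xor b k l j = trans
    (combination-cong {b = b} (λ i → ι-xor (k i) (l i)) (λ _ _ → refl) j)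
    (combination-+ (ι ∘ k) (ι ∘ l) b j)

  emb-false : ∀ (b : Fin r → V d) {k} → (∀ i → k i ≡ false) → emb b k ≋ 0ᵥ
  emb-false b k≗0 = combination-zero b (λ i → ι-cong (k≗0 i))

  emb-δ : ∀ (b : Fin r → V d) i → emb b (δ i) ≋ b i
  emb-δ b zero    j = trans
    (+-cong (*-identityˡ _) (combination-zero (b ∘ suc) (λ _ → refl) j)) (+-identityʳ _)
  emb-δ b (suc i) j = trans (+-cong (zeroˡ _) (emb-δ (b ∘ suc) i j)) (+-identityˡ _)

  emb-∙ : ∀ c (b : Fin r → V d) k → emb (λ i → c ∙ b i) k ≋ c ∙ emb b k
  emb-∙ c b k j = trans
    (sum-cong-≋ (λ i → solve 3 (λ x c y → x :* (c :* y) := c :* (x :* y)) refl (ι (k i)) c (b i j)))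
    (sym (*-distribˡ-sum c (λ i → ι (k i) * b i j)))

  -- Change of frame: after an interchange of the two sums, coordinates are multiplied by the
  -- 𝔽₂-matrix `E`.
  emb-emb : ∀ (u : Fin m → V d) (E : Fin r → Fin m → Bool) k →
    emb (λ i → emb u (E i)) k ≋ emb u (k · E)
  emb-emb u E k j = begin
    sum (λ i → ι (k i) * sum (λ l → ι (E i l) * u l j))    ≈⟨ sum-cong-≋ (λ i → *-distribˡ-sum (ι (k i)) (λ l → ι (E i l) * u l j)) ⟩
    sum (λ i → sum (λ l → ι (k i) * (ι (E i l) * u l j)))  ≈⟨ ∑-comm (λ i l → ι (k i) * (ι (E i l) * u l j)) ⟩
    sum (λ l → sum (λ i → ι (k i) * (ι (E i l) * u l j)))  ≈⟨ sum-cong-≋ coordinate ⟩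
    sum (λ l → ι ((k · E) l) * u l j)                      ∎
    where
    coordinate : ∀ l → sum (λ i → ι (k i) * (ι (E i l) * u l j)) ≈ ι ((k · E) l) * u l j
    coordinate l = begin
      sum (λ i → ι (k i) * (ι (E i l) * u l j))  ≈⟨ sum-cong-≋ (λ i → trans (sym (*-assoc _ _ _)) (*-congʳ (sym (ι-∧ (k i) (E i l))))) ⟩
      sum (λ i → ι (k i ∧ E i l) * u l j)        ≈⟨ *-distribʳ-sum (u l j) (λ i → ι (k i ∧ E i l)) ⟨
      sum (λ i → ι (k i ∧ E i l)) * u l j        ≈⟨ *-congʳ (ι-sum (λ i → k i ∧ E i l)) ⟨
      ι ((k · E) l) * u l j                      ∎

-- Vectors with 𝔽₂-coordinates in an independent family.

module IndependentFamily (𝔽 : Field) (1+1≈0 : HasCharacteristicTwo 𝔽) {d r : ℕ}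
                         (e : Fin r → Projective.V 𝔽 d)
                         (independent : Projective.Independent 𝔽 e) where
  open Field 𝔽
  open FieldProperties 𝔽
  open CharacteristicTwo 𝔽 1+1≈0
  open Combinations 𝔽 1+1≈0
  open Projective 𝔽
  open SetoidReasoning setoid

  emb-coordinates : ∀ {α β γ} k l m → (α ∙ emb e k) +ᵥ (β ∙ emb e l) ≋ γ ∙ emb e m →
    ∀ j → α * ι (k j) + β * ι (l j) ≈ γ * ι (m j)
  emb-coordinates {α} {β} {γ} k l m eq =
    combination-injective e independent _ _ λ j → begin
      combination (λ i → α * ι (k i) + β * ι (l i)) e j  ≈⟨ combination-+ (λ i → α * ι (k i)) (λ i → β * ι (l i)) e j ⟩
      combination (λ i → α * ι (k i)) e j + combination (λ i → β * ι (l i)) e j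
        ≈⟨ +-cong (combination-∙ α (ι ∘ k) e j) (combination-∙ β (ι ∘ l) e j) ⟩
      α * emb e k j + β * emb e l j                      ≈⟨ eq j ⟩
      γ * emb e m j                                      ≈⟨ combination-∙ γ (ι ∘ m) e j ⟨
      combination (λ i → γ * ι (m i)) e j                ∎

  -- A non-zero scalar does not change which coordinates vanish, and over 𝔽₂ this pattern determines
  -- the vector. So each point has at most one coordinate vector over 𝔽₂.
  scaled-injective : ∀ {α β} k l → ¬ (α ≈ 0#) → ¬ (β ≈ 0#) → α ∙ emb e k ≋ β ∙ emb e l →
    ∀ j → k j ≡ l j
  scaled-injective {α} {β} k l α≉0 β≉0 eq j = compare (k j) (l j) coordinate
    where
    coordinate : α * ι (k j) ≈ β * ι (l j)
    coordinate = combination-injective e independent _ _ (λ i → trans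
      (combination-∙ α (ι ∘ k) e i) (trans (eq i) (sym (combination-∙ β (ι ∘ l) e i)))) j
    compare : ∀ a b → α * ι a ≈ β * ι b → a ≡ b
    compare true  true  _  = ≡.refl
    compare true  false eq = ⊥-elim (*-nonzero α≉0 (0≉1 ∘ sym) (trans eq (zeroʳ β)))
    compare false true  eq = ⊥-elim (*-nonzero β≉0 (0≉1 ∘ sym) (trans (sym eq) (zeroʳ α)))
    compare false false _  = ≡.refl

  emb-nonzero : ∀ {k} → ¬ (∀ j → k j ≡ false) → ¬ (emb e k ≋ 0ᵥ)
  emb-nonzero {k} k≢0 k≋0 = k≢0 (λ j → ι-injective (k j) false (independent (ι ∘ k) k≋0 j))

  module _ (b : Fin 2 → Fin r → Bool)
           (b₀≢0 : ¬ (∀ j → b 0F j ≡ false)) (b₁≢0 : ¬ (∀ j → b 1F j ≡ false))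
           (b₀≢b₁ : ¬ (∀ j → b 0F j ≡ b 1F j)) where

    -- Independence over 𝔽₂ persists over 𝔽: apply `solve-F₂` with right-hand factor 0, for which
    -- any third vector will do, here `b 0F`.
    emb-independent : ∀ {α β} → (α ∙ emb e (b 0F)) +ᵥ (β ∙ emb e (b 1F)) ≋ 0ᵥ → α ≈ 0# × β ≈ 0#
    emb-independent {α} {β} eq with solve-F₂ (b 0F) (b 1F) (b 0F) α β 0#
      (emb-coordinates (b 0F) (b 1F) (b 0F) (λ j → trans (eq j) (sym (zeroˡ _)))) b₀≢0 b₁≢0 b₀≢b₁
    ... | _ , _ , α≈ , β≈ = trans α≈ (zeroˡ _) , trans β≈ (zeroˡ _)

-- Quadratic forms in characteristic two and their values on 𝔽₂-combinations.

module QuadraticForm (𝔽 : Field) (1+1≈0 : HasCharacteristicTwo 𝔽) {d : ℕ}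
                     (f : Projective.V 𝔽 d → Field.Carrier 𝔽)
                     (isQ : Projective.IsQuadraticForm 𝔽 f) where
  open Field 𝔽
  open CharacteristicTwo 𝔽 1+1≈0
  open Combinations 𝔽 1+1≈0
  open Projective 𝔽
  open IsQuadraticForm isQ public renaming (cong to f-cong)
  open Sum semiring
  open SetoidReasoning setoid

  private variable
    m r : ℕ

  f-+ : ∀ u v → f (u +ᵥ v) ≈ f u + f v + polar f u v
  f-+ u v = solve 3 (λ x y z → x := y :+ z :+ (x :- y :- z)) refl (f (u +ᵥ v)) (f u) (f v)

  f-0ᵥ : f 0ᵥ ≈ 0#
  f-0ᵥ = trans (f-cong (λ _ → sym (zeroˡ 0#))) (trans (homogen 0# 0ᵥ)
    (trans (*-congʳ (zeroˡ 0#)) (zeroˡ _)))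

  f-zero : ∀ {v} → v ≋ 0ᵥ → f v ≈ 0#
  f-zero v≋0 = trans (f-cong v≋0) f-0ᵥ

  polar-cong : ∀ {u u′ v v′} → u ≋ u′ → v ≋ v′ → polar f u v ≈ polar f u′ v′
  polar-cong u≋ v≋ = +-cong (+-cong (f-cong (λ j → +-cong (u≋ j) (v≋ j)))
    (-‿cong (f-cong u≋))) (-‿cong (f-cong v≋))

  polar-comm : ∀ u v → polar f u v ≈ polar f v u
  polar-comm u v = begin
    f (u +ᵥ v) - f u - f v  ≈⟨ +-congʳ (+-congʳ (f-cong (λ j → +-comm (u j) (v j)))) ⟩
    f (v +ᵥ u) - f u - f v  ≈⟨ solve 3 (λ x y z → x :- y :- z := x :- z :- y) refl _ (f u) (f v) ⟩
    f (v +ᵥ u) - f v - f u  ∎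

  polar-+ʳ : ∀ w u v → polar f w (u +ᵥ v) ≈ polar f w u + polar f w v
  polar-+ʳ w u v = trans (polar-comm w _)
    (trans (polar-+ u v w) (+-cong (polar-comm u w) (polar-comm v w)))

  polar-∙ʳ : ∀ c u v → polar f u (c ∙ v) ≈ c * polar f u v
  polar-∙ʳ c u v = trans (polar-comm u _) (trans (polar-∙ c v u) (*-congˡ (polar-comm v u)))

  polar-self : ∀ v → polar f v v ≈ 0#
  polar-self v = begin
    f (v +ᵥ v) - f v - f v  ≈⟨ solve 2 (λ x y → x :- y :- y := x) refl _ (f v) ⟩
    f (v +ᵥ v)              ≈⟨ f-zero (λ j → x+x≈0 (v j)) ⟩
    0#                      ∎

  polar-0ˡ : ∀ {u} v → u ≋ 0ᵥ → polar f u v ≈ 0#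
  polar-0ˡ {u} v u≋0 = begin
    polar f u v         ≈⟨ polar-cong (λ j → trans (u≋0 j) (sym (zeroˡ 0#))) (λ _ → refl) ⟩
    polar f (0# ∙ 0ᵥ) v ≈⟨ polar-∙ 0# 0ᵥ v ⟩
    0# * polar f 0ᵥ v   ≈⟨ zeroˡ _ ⟩
    0#                  ∎

  polar-combination : ∀ k (b : Fin r → V d) v →
    polar f (combination k b) v ≈ sum (λ i → k i * polar f (b i) v)
  polar-combination {zero}  k b v = polar-0ˡ v (λ _ → refl)
  polar-combination {suc r} k b v = begin
    polar f (combination k b) v
      ≈⟨ polar-+ (k 0F ∙ b 0F) (combination (k ∘ suc) (b ∘ suc)) v ⟩
    polar f (k 0F ∙ b 0F) v + polar f (combination (k ∘ suc) (b ∘ suc)) v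
      ≈⟨ +-cong (polar-∙ (k 0F) (b 0F) v) (polar-combination (k ∘ suc) (b ∘ suc) v) ⟩
    sum (λ i → k i * polar f (b i) v) ∎

  -- Induction on the number of vectors: in the expansion of `f` at the first term plus the rest,
  -- all three summands vanish.
  totallySingular : ∀ (b : Fin r → V d) → (∀ i → f (b i) ≈ 0#) →
    (∀ i j → polar f (b i) (b j) ≈ 0#) → TotallySingular f b
  totallySingular b f≈0 polar≈0 v (k , v≋) = trans (f-cong v≋) (vanish b f≈0 polar≈0 k)
    where
    vanish : ∀ {r} (b : Fin r → V d) → (∀ i → f (b i) ≈ 0#) →
      (∀ i j → polar f (b i) (b j) ≈ 0#) → ∀ k → f (combination k b) ≈ 0#
    vanish {zero}  b f≈0 polar≈0 k = f-0ᵥ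
    vanish {suc r} b f≈0 polar≈0 k = begin
      f (k 0F ∙ b 0F +ᵥ rest)                               ≈⟨ f-+ (k 0F ∙ b 0F) rest ⟩
      f (k 0F ∙ b 0F) + f rest + polar f (k 0F ∙ b 0F) rest
        ≈⟨ +-cong (+-cong (trans (homogen (k 0F) (b 0F)) (trans (*-congˡ (f≈0 0F)) (zeroʳ _)))
                          (vanish (b ∘ suc) (f≈0 ∘ suc) (λ i j → polar≈0 (suc i) (suc j)) (k ∘ suc)))
                  (trans (polar-∙ (k 0F) (b 0F) rest) (trans (*-congˡ polar-rest) (zeroʳ _))) ⟩
      0# + 0# + 0#                                          ≈⟨ solve 0 (con false :+ con false :+ con false := con false) refl ⟩
      0#                                                    ∎
      where
      rest : V d
      rest = combination (k ∘ suc) (b ∘ suc)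
      polar-rest : polar f (b 0F) rest ≈ 0#
      polar-rest = begin
        polar f (b 0F) rest                                     ≈⟨ polar-comm (b 0F) rest ⟩
        polar f rest (b 0F)                                     ≈⟨ polar-combination (k ∘ suc) (b ∘ suc) (b 0F) ⟩
        sum (λ i → k (suc i) * polar f (b (suc i)) (b 0F))      ≈⟨ sum-cong-≋ (λ i → trans (*-congˡ (polar≈0 (suc i) 0F)) (zeroʳ _)) ⟩
        sum {r} (λ _ → 0#)                                      ≈⟨ sum-replicate-zero r ⟩
        0#                                                      ∎

  -- This says, without dividing, that `f / s` is the form `q` on the 𝔽₂-combinations of `e`.
  Represents : Scalar → ((Fin r → Bool) → Bool) → (Fin r → V d) → Set
  Represents s q e = ∀ k → f (emb e k) ≈ s * ι (q k)

  -- The diagonal of a Gram matrix carries the values of f, since the polar form alternates.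
  record HasGram (s : Scalar) (u : Fin m → V d) (G : Fin m → Fin m → Bool) : Set where
    field
      f-diagonal : ∀ i → f (u i) ≈ s * ι (G i i)
      polar-off  : ∀ i j → i ≢ j → polar f (u i) (u j) ≈ s * ι (G i j)

  -- Splitting off the first vector follows the recursion of `gramForm`: its diagonal term, the form
  -- on the rest, and the polar product of the two.
  f-emb : ∀ {s} {u : Fin m → V d} {G} → HasGram s u G → Represents s (gramForm G) u
  f-emb {zero}  {s}         gram k = trans f-0ᵥ (sym (zeroʳ s))
  f-emb {suc m} {s} {u} {G} gram k = begin
    f (emb u k)                          ≈⟨ f-+ (x ∙ u 0F) rest ⟩
    f (x ∙ u 0F) + f rest + polar f (x ∙ u 0F) rest
      ≈⟨ +-cong (+-cong (trans (homogen x (u 0F)) (*-congˡ (f-diagonal 0F))) (f-emb tail (k ∘ suc)))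
                (trans (polar-∙ x (u 0F) rest) (*-congˡ polar-rest)) ⟩
    x * x * (s * ι (G 0F 0F)) + s * ι g + x * (s * ι p)
      -- Elements of 𝔽₂ are idempotent, so the square coming from homogeneity disappears.
      ≈⟨ +-congʳ (+-congʳ (*-congʳ (trans (sym (ι-∧ (k 0F) (k 0F))) (ι-cong (Bool.∧-idem (k 0F)))))) ⟩
    x * (s * ι (G 0F 0F)) + s * ι g + x * (s * ι p)
      ≈⟨ solve 5 (λ x s y z w → x :* (s :* y) :+ s :* z :+ x :* (s :* w) := s :* (x :* y :+ z :+ x :* w))
               refl x s _ _ _ ⟩
    s * (x * ι (G 0F 0F) + ι g + x * ι p)
      ≈⟨ *-congˡ (+-cong (trans (ι-xor (k 0F ∧ G 0F 0F) g) (+-congʳ (ι-∧ (k 0F) _))) (ι-∧ (k 0F) p)) ⟨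
    s * (ι ((k 0F ∧ G 0F 0F) xor g) + ι (k 0F ∧ p))
      ≈⟨ *-congˡ (ι-xor ((k 0F ∧ G 0F 0F) xor g) (k 0F ∧ p)) ⟨
    s * ι (gramForm G k)                 ∎
    where
    open HasGram gram
    x : Scalar
    x = ι (k 0F)
    rest : V d
    rest = emb (u ∘ suc) (k ∘ suc)
    g p : Bool
    g = gramForm (λ i j → G (suc i) (suc j)) (k ∘ suc)
    p = xor-sum (λ i → k (suc i) ∧ G 0F (suc i))
    tail : HasGram s (u ∘ suc) (λ i j → G (suc i) (suc j))
    tail = record
      { f-diagonal = λ i → f-diagonal (suc i)
      ; polar-off  = λ i j i≢j → polar-off (suc i) (suc j) (i≢j ∘ Fin.suc-injective)
      }
    polar-rest : polar f (u 0F) rest ≈ s * ι p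
    polar-rest = begin
      polar f (u 0F) rest                                    ≈⟨ polar-comm _ _ ⟩
      polar f rest (u 0F)                                    ≈⟨ polar-combination (ι ∘ k ∘ suc) (u ∘ suc) (u 0F) ⟩
      sum (λ i → ι (k (suc i)) * polar f (u (suc i)) (u 0F)) ≈⟨ sum-cong-≋ term ⟩
      sum (λ i → s * ι (k (suc i) ∧ G 0F (suc i)))           ≈⟨ *-distribˡ-sum s (λ i → ι (k (suc i) ∧ G 0F (suc i))) ⟨
      s * sum (λ i → ι (k (suc i) ∧ G 0F (suc i)))           ≈⟨ *-congˡ (ι-sum (λ i → k (suc i) ∧ G 0F (suc i))) ⟨
      s * ι p                                                ∎
      where
      term : ∀ i → ι (k (suc i)) * polar f (u (suc i)) (u 0F) ≈ s * ι (k (suc i) ∧ G 0F (suc i))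
      term i = begin
        ι (k (suc i)) * polar f (u (suc i)) (u 0F)  ≈⟨ *-congˡ (trans (polar-comm _ _) (polar-off 0F (suc i) (λ ()))) ⟩
        ι (k (suc i)) * (s * ι (G 0F (suc i)))      ≈⟨ solve 3 (λ x s y → x :* (s :* y) := s :* (x :* y)) refl _ s _ ⟩
        s * (ι (k (suc i)) * ι (G 0F (suc i)))      ≈⟨ *-congˡ (ι-∧ (k (suc i)) _) ⟨
        s * ι (k (suc i) ∧ G 0F (suc i))            ∎

  polar-emb : ∀ {s} (q : (Fin r → Bool) → Bool) (e : Fin r → V d) → Represents s q e → ∀ k l →
    polar f (emb e k) (emb e l) ≈ s * ι (polarForm q k l)
  polar-emb {s = s} q e f≈ k l = begin
    f (emb e k +ᵥ emb e l) - f (emb e k) - f (emb e l)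
      ≈⟨ +-cong (+-cong (trans (f-cong (≋-sym (emb-xor e k l))) (f≈ _)) (-‿cong (f≈ k))) (-‿cong (f≈ l)) ⟩
    s * ι (q k+l) - s * ι (q k) - s * ι (q l)
      ≈⟨ solve 4 (λ s x y z → s :* x :- s :* y :- s :* z := s :* (x :+ (y :+ z))) refl s _ _ _ ⟩
    s * (ι (q k+l) + (ι (q k) + ι (q l)))
      ≈⟨ *-congˡ (trans (ι-xor (q k+l) _) (+-congˡ (ι-xor (q k) (q l)))) ⟨
    s * ι (q k+l xor (q k xor q l)) ∎
    where
    k+l : Fin _ → Bool
    k+l i = k i xor l i

-- Points and lines of projective spaces over 𝔽₂.

module BooleanPairs where
  open Projective 𝔽₂

  private variable
    r : ℕ

  xor≡false : ∀ a b → a xor b ≡ false → a ≡ b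
  xor≡false true  true  _ = ≡.refl
  xor≡false false false _ = ≡.refl

  -- There are only four pairs of coefficients over 𝔽₂, and each hypothesis excludes one of the
  -- three non-zero pairs.
  pair-independent : ∀ (b : Fin 2 → V r) →
    ¬ (∀ j → b 0F j ≡ false) → ¬ (∀ j → b 1F j ≡ false) → ¬ (∀ j → b 0F j ≡ b 1F j) →
    Independent b
  pair-independent b b₀≢0 b₁≢0 b₀≢b₁ k kb≡0 = cases (k 0F) (k 1F) ≡.refl ≡.refl
    where
    coordinate : ∀ {x y} → k 0F ≡ x → k 1F ≡ y → ∀ j →
      (x ∧ b 0F j) xor (y ∧ b 1F j) ≡ false
    coordinate ≡.refl ≡.refl j = ≡.trans
      (≡.cong ((k 0F ∧ b 0F j) xor_) (≡.sym (Bool.xor-identityʳ _))) (kb≡0 j)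
    cases : ∀ x y → k 0F ≡ x → k 1F ≡ y → ∀ i → k i ≡ false
    cases true  true  k₀ k₁ i = ⊥-elim (b₀≢b₁ (λ j → xor≡false _ _ (coordinate k₀ k₁ j)))
    cases true  false k₀ k₁ i =
      ⊥-elim (b₀≢0 (λ j → ≡.trans (≡.sym (Bool.xor-identityʳ _)) (coordinate k₀ k₁ j)))
    cases false true  k₀ k₁ i = ⊥-elim (b₁≢0 (coordinate k₀ k₁))
    cases false false k₀ k₁ 0F = k₀
    cases false false k₀ k₁ 1F = k₁

  module _ (b : Fin 2 → V r) (ind : Independent b) where

    independent⇒nonzero₀ : ¬ (∀ j → b 0F j ≡ false)
    independent⇒nonzero₀ b₀≡0 with () ←
      ind (λ { 0F → true ; 1F → false }) (λ j → ≡.cong (_xor false) (b₀≡0 j)) 0F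

    independent⇒nonzero₁ : ¬ (∀ j → b 1F j ≡ false)
    independent⇒nonzero₁ b₁≡0 with () ←
      ind (λ { 0F → false ; 1F → true }) (λ j → ≡.cong (_xor false) (b₁≡0 j)) 1F

    independent⇒distinct : ¬ (∀ j → b 0F j ≡ b 1F j)
    independent⇒distinct b₀≡b₁ with () ← ind (λ _ → true) (λ j →
      ≡.trans (≡.cong₂ _xor_ (b₀≡b₁ j) (Bool.xor-identityʳ _)) (Bool.xor-same (b 1F j))) 0F

  -- The only non-zero scalar of 𝔽₂ is 1, so a point has a single representing vector.
  ≈ₚ⇒≗ : {p q : Point r} → p ≈ₚ q → ∀ i → vec p i ≡ vec q i
  ≈ₚ⇒≗ (true  , _      , p≡q) = p≡q
  ≈ₚ⇒≗ (false , 0≢0    , _)   = ⊥-elim (0≢0 ≡.refl)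

  ≗⇒≈ₚ : {p q : Point r} → (∀ i → vec p i ≡ vec q i) → p ≈ₚ q
  ≗⇒≈ₚ p≡q = true , (λ ()) , p≡q

-- The singular points of the 𝔽₂-subgeometry on a frame.

module BooleanFrame (𝔽 : Field) (1+1≈0 : HasCharacteristicTwo 𝔽) {d : ℕ}
                    (f : Projective.V 𝔽 d → Projective.Scalar 𝔽)
                    (isQ : Projective.IsQuadraticForm 𝔽 f)
                    (B : Projective.Frame 𝔽 d)
                    {s : Projective.Scalar 𝔽} (s≉0 : ¬ (Field._≈_ 𝔽 s (Field.0# 𝔽)))
                    (q : (Fin (Projective.Frame.rank B) → Bool) → Bool)
                    (f≈ : QuadraticForm.Represents 𝔽 1+1≈0 f isQ s q (Projective.Frame.basis B)) where
  open Projective 𝔽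
  open Frame B renaming (basis to e)
  open Field 𝔽
  open FieldProperties 𝔽
  open CharacteristicTwo 𝔽 1+1≈0
  open Combinations 𝔽 1+1≈0
  open IndependentFamily 𝔽 1+1≈0 e independent
  open QuadraticForm 𝔽 1+1≈0 f isQ
  open BooleanPairs
  open SetoidReasoning setoid
  private
    module P₂ = Projective 𝔽₂
    r : ℕ
    r = rank

  sι≈0⇒false : ∀ {a} → s * ι a ≈ 0# → a ≡ false
  sι≈0⇒false {a} eq = ι-injective a false (cancelˡ s≉0 eq)

  q-false : ∀ {k c v} → ¬ (c ≈ 0#) → v ≋ c ∙ emb e k → f v ≈ 0# → q k ≡ false
  q-false {k} {c} {v} c≉0 v≋ fv≈0 = sι≈0⇒false (trans (sym (f≈ k))
    (cancelˡ (*-nonzero c≉0 c≉0) (trans (sym (homogen c (emb e k)))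
      (trans (f-cong (≋-sym v≋)) fv≈0))))

  f-false : ∀ {k c v} → v ≋ c ∙ emb e k → q k ≡ false → f v ≈ 0#
  f-false {k} {c} {v} v≋ qk = begin
    f v                       ≈⟨ f-cong v≋ ⟩
    f (c ∙ emb e k)           ≈⟨ homogen c (emb e k) ⟩
    c * c * f (emb e k)       ≈⟨ *-congˡ (trans (f≈ k) (*-congˡ (ι-cong qk))) ⟩
    c * c * (s * 0#)          ≈⟨ solve 2 (λ c s → c :* c :* (s :* con false) := con false) refl c s ⟩
    0#                        ∎

  -- The scalar `c` makes membership independent of the representing vector. The coordinates `k` are
  -- kept in the membership proof, from which the isomorphism with the quadric reads them off.
  S : Pred (Point d) 0ℓ
  S p = ∃₂ λ k c → ¬ (c ≈ 0#) × q k ≡ false × vec p ≋ c ∙ emb e k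

  S-respects : ∀ {p p′} → p ≈ₚ p′ → S p → S p′
  S-respects {p} {p′} p≈p′ (k , c , c≉0 , qk , p≋) with unscale (proj₁ (proj₂ p≈p′)) (proj₂ (proj₂ p≈p′))
  ... | a , a≉0 , p′≋ = k , a * c , *-nonzero a≉0 c≉0 , qk ,
    λ j → trans (p′≋ j) (trans (*-congˡ (p≋ j)) (sym (*-assoc a c _)))

  S⊆Singular : ∀ {p} → S p → Singular f p
  S⊆Singular (k , c , c≉0 , qk , p≋) = f-false p≋ qk

  ι∈F₂ : ∀ a → ι a ∈ F₂
  ι∈F₂ true  = inj₂ refl
  ι∈F₂ false = inj₁ refl

  S⊆subgeometry : S ⊆ subgeometry F₂ B
  S⊆subgeometry (k , c , c≉0 , qk , p≋) = ι ∘ k , c , (λ i → ι∈F₂ (k i)) , c≉0 , p≋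

  F₂-isSubfield : IsSubfield F₂
  F₂-isSubfield = record
    { resp = λ { x≈y (inj₁ x≈0) → inj₁ (trans (sym x≈y) x≈0)
               ; x≈y (inj₂ x≈1) → inj₂ (trans (sym x≈y) x≈1) }
    ; 0∈   = inj₁ refl
    ; 1∈   = inj₂ refl
    ; +∈   = λ { (inj₁ x) (inj₁ y) → inj₁ (trans (+-cong x y) (+-identityʳ _))
               ; (inj₁ x) (inj₂ y) → inj₂ (trans (+-cong x y) (+-identityˡ _))
               ; (inj₂ x) (inj₁ y) → inj₂ (trans (+-cong x y) (+-identityʳ _))
               ; (inj₂ x) (inj₂ y) → inj₁ (trans (+-cong x y) 1+1≈0) }
    ; *∈   = λ { (inj₁ x) _        → inj₁ (trans (*-congʳ x) (zeroˡ _))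
               ; (inj₂ x) (inj₁ y) → inj₁ (trans (*-congˡ y) (zeroʳ _))
               ; (inj₂ x) (inj₂ y) → inj₂ (trans (*-cong x y) (*-identityˡ _)) }
    ; -∈   = λ { (inj₁ x) → inj₁ (trans (-x≈x _) x)
               ; (inj₂ x) → inj₂ (trans (-x≈x _) x) }
    ; ⁻¹∈  = λ { (inj₁ x) xy≈1 → ⊥-elim (0≉1 (trans (trans (sym (zeroˡ _)) (*-congʳ (sym x))) xy≈1))
               ; (inj₂ x) xy≈1 → inj₂ (trans (trans (sym (*-identityˡ _)) (*-congʳ (sym x))) xy≈1) }
    }

  -- Minimality is automatic, since every subfield contains 0 and 1.
  F₂-isFieldOf : IsFieldOf S F₂
  F₂-isFieldOf = record
    { isSubfield = F₂-isSubfield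
    ; definedOver = B , λ {p} → S⊆subgeometry {p}
    ; least = λ { K′ K′-sub _ (inj₁ x≈0) → IsSubfield.resp K′-sub (sym x≈0) (IsSubfield.0∈ K′-sub)
                ; K′ K′-sub _ (inj₂ x≈1) → IsSubfield.resp K′-sub (sym x≈1) (IsSubfield.1∈ K′-sub) }
    }

  combination₂ : ∀ (b : Fin 2 → V d) k → combination k b ≋ (k 0F ∙ b 0F) +ᵥ (k 1F ∙ b 1F)
  combination₂ b k j = +-congˡ (+-identityʳ _)

  emb-combination₂ : ∀ (b : Fin 2 → Fin r → Bool) κ {k} → (∀ j → k j ≡ P₂.combination κ b j) →
    emb e k ≋ (ι (κ 0F) ∙ emb e (b 0F)) +ᵥ (ι (κ 1F) ∙ emb e (b 1F))
  emb-combination₂ b κ {k} k≗ j = begin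
    emb e k j                                                        ≈⟨ emb-cong e k≗′ j ⟩
    emb e (λ i → (κ 0F ∧ b 0F i) xor (κ 1F ∧ b 1F i)) j              ≈⟨ emb-xor e (λ i → κ 0F ∧ b 0F i) _ j ⟩
    emb e (λ i → κ 0F ∧ b 0F i) j + emb e (λ i → κ 1F ∧ b 1F i) j    ≈⟨ +-cong (emb-∧ 0F) (emb-∧ 1F) ⟩
    ι (κ 0F) * emb e (b 0F) j + ι (κ 1F) * emb e (b 1F) j            ∎
    where
    k≗′ : ∀ i → k i ≡ (κ 0F ∧ b 0F i) xor (κ 1F ∧ b 1F i)
    k≗′ i = ≡.trans (k≗ i) (≡.cong ((κ 0F ∧ b 0F i) xor_) (Bool.xor-identityʳ _))
    emb-∧ : ∀ a → emb e (λ i → κ a ∧ b a i) j ≈ ι (κ a) * emb e (b a) j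
    emb-∧ a = trans (combination-cong {b = e} (λ i → ι-∧ (κ a) (b a i)) (λ _ _ → refl) j)
                    (combination-∙ (ι (κ a)) (ι ∘ b a) e j)

  module _ (b : Fin 2 → Fin r → Bool)
           (b₀≢0 : ¬ (∀ j → b 0F j ≡ false)) (b₁≢0 : ¬ (∀ j → b 1F j ≡ false))
           (b₀≢b₁ : ¬ (∀ j → b 0F j ≡ b 1F j)) where

    -- Three vectors in the span of l 0F and l 1F are dependent with the 2 × 2 minors as
    -- coefficients; these coefficients are proportional to elements of 𝔽₂.
    span⇒span₂ : ∀ {l : Fin 2 → V d} → Span l (emb e (b 0F)) → Span l (emb e (b 1F)) →
      ∀ {k} → Span l (emb e k) → P₂.Span b k
    span⇒span₂ {l} (x , b₀≋) (y , b₁≋) {k} (z , k≋) = conclude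
      (solve-F₂ (b 0F) (b 1F) k D₀ D₁ D (emb-coordinates (b 0F) (b 1F) k dependence) b₀≢0 b₁≢0 b₀≢b₁)
      where
      D₀ D₁ D : Scalar
      D₀ = z 0F * y 1F + z 1F * y 0F
      D₁ = z 0F * x 1F + z 1F * x 0F
      D  = x 0F * y 1F + x 1F * y 0F

      dependence : (D₀ ∙ emb e (b 0F)) +ᵥ (D₁ ∙ emb e (b 1F)) ≋ D ∙ emb e k
      dependence j = begin
        D₀ * emb e (b 0F) j + D₁ * emb e (b 1F) j
          ≈⟨ +-cong (*-congˡ (trans (b₀≋ j) (combination₂ l x j))) (*-congˡ (trans (b₁≋ j) (combination₂ l y j))) ⟩
        D₀ * (x 0F * l 0F j + x 1F * l 1F j) + D₁ * (y 0F * l 0F j + y 1F * l 1F j)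
          ≈⟨ solve 8 (λ x₀ x₁ y₀ y₁ z₀ z₁ l₀ l₁ →
               (z₀ :* y₁ :+ z₁ :* y₀) :* (x₀ :* l₀ :+ x₁ :* l₁) :+
               (z₀ :* x₁ :+ z₁ :* x₀) :* (y₀ :* l₀ :+ y₁ :* l₁)
               := (x₀ :* y₁ :+ x₁ :* y₀) :* (z₀ :* l₀ :+ z₁ :* l₁)) refl
               (x 0F) (x 1F) (y 0F) (y 1F) (z 0F) (z 1F) (l 0F j) (l 1F j) ⟩
        D * (z 0F * l 0F j + z 1F * l 1F j)
          ≈⟨ *-congˡ (trans (k≋ j) (combination₂ l z j)) ⟨
        D * emb e k j ∎

      -- If the minor `D` vanished, eliminating one vector of `l` at a time would give two relations
      -- between the independent vectors `emb e (b 0F)` and `emb e (b 1F)`. They force both entries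
      -- of `x` to vanish, and with them `emb e (b 0F)`.
      D≉0 : ¬ (D ≈ 0#)
      D≉0 D≈0 = emb-nonzero b₀≢0 λ j → begin
        emb e (b 0F) j                ≈⟨ trans (b₀≋ j) (combination₂ l x j) ⟩
        x 0F * l 0F j + x 1F * l 1F j ≈⟨ +-cong (*-congʳ (proj₂ (emb-independent b b₀≢0 b₁≢0 b₀≢b₁ eliminate₀))) (*-congʳ (proj₂ (emb-independent b b₀≢0 b₁≢0 b₀≢b₁ eliminate₁))) ⟩
        0# * l 0F j + 0# * l 1F j     ≈⟨ solve 2 (λ a b → con false :* a :+ con false :* b := con false) refl (l 0F j) (l 1F j) ⟩
        0#                            ∎
        where
        expand : ∀ c j → y c * emb e (b 0F) j + x c * emb e (b 1F) j ≈
          y c * (x 0F * l 0F j + x 1F * l 1F j) + x c * (y 0F * l 0F j + y 1F * l 1F j)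
        expand c j = +-cong (*-congˡ (trans (b₀≋ j) (combination₂ l x j)))
                            (*-congˡ (trans (b₁≋ j) (combination₂ l y j)))
        vanish : ∀ a → D * a ≈ 0#
        vanish a = trans (*-congʳ D≈0) (zeroˡ a)
        eliminate₀ : (y 0F ∙ emb e (b 0F)) +ᵥ (x 0F ∙ emb e (b 1F)) ≋ 0ᵥ
        eliminate₀ j = trans (expand 0F j) (trans
          (solve 6 (λ x₀ x₁ y₀ y₁ l₀ l₁ → y₀ :* (x₀ :* l₀ :+ x₁ :* l₁) :+ x₀ :* (y₀ :* l₀ :+ y₁ :* l₁)
             := (x₀ :* y₁ :+ x₁ :* y₀) :* l₁) refl (x 0F) (x 1F) (y 0F) (y 1F) (l 0F j) (l 1F j))
          (vanish (l 1F j)))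
        eliminate₁ : (y 1F ∙ emb e (b 0F)) +ᵥ (x 1F ∙ emb e (b 1F)) ≋ 0ᵥ
        eliminate₁ j = trans (expand 1F j) (trans
          (solve 6 (λ x₀ x₁ y₀ y₁ l₀ l₁ → y₁ :* (x₀ :* l₀ :+ x₁ :* l₁) :+ x₁ :* (y₀ :* l₀ :+ y₁ :* l₁)
             := (x₀ :* y₁ :+ x₁ :* y₀) :* l₀) refl (x 0F) (x 1F) (y 0F) (y 1F) (l 0F j) (l 1F j))
          (vanish (l 0F j)))

      conclude : (∃₂ λ κ₀ κ₁ → D₀ ≈ D * ι κ₀ × D₁ ≈ D * ι κ₁) → P₂.Span b k
      conclude (κ₀ , κ₁ , D₀≈ , D₁≈) = (λ { 0F → κ₀ ; 1F → κ₁ }) , λ i → ≡.trans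
        (≡.sym (ι-injective ((κ₀ ∧ b 0F i) xor (κ₁ ∧ b 1F i)) (k i) (*-cancelˡ-nonzero D≉0 (coordinate i))))
        (≡.cong ((κ₀ ∧ b 0F i) xor_) (≡.sym (Bool.xor-identityʳ _)))
        where
        coordinate : ∀ i → D * ι ((κ₀ ∧ b 0F i) xor (κ₁ ∧ b 1F i)) ≈ D * ι (k i)
        coordinate i = begin
          D * ι ((κ₀ ∧ b 0F i) xor (κ₁ ∧ b 1F i))
            ≈⟨ *-congˡ (trans (ι-xor (κ₀ ∧ b 0F i) _) (+-cong (ι-∧ κ₀ (b 0F i)) (ι-∧ κ₁ (b 1F i)))) ⟩
          D * (ι κ₀ * ι (b 0F i) + ι κ₁ * ι (b 1F i))
            ≈⟨ solve 5 (λ D x y z w → D :* (x :* y :+ z :* w) := D :* x :* y :+ D :* z :* w) refl D (ι κ₀) _ (ι κ₁) _ ⟩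
          D * ι κ₀ * ι (b 0F i) + D * ι κ₁ * ι (b 1F i)
            ≈⟨ +-cong (*-congʳ D₀≈) (*-congʳ D₁≈) ⟨
          D₀ * ι (b 0F i) + D₁ * ι (b 1F i)
            ≈⟨ emb-coordinates (b 0F) (b 1F) k dependence i ⟩
          D * ι (k i) ∎

  span₂⇒span : ∀ (l : Fin 2 → V d) (b : Fin 2 → Fin r → Bool) →
    Span l (emb e (b 0F)) → Span l (emb e (b 1F)) → ∀ {k} → P₂.Span b k → Span l (emb e k)
  span₂⇒span l b b₀∈l b₁∈l (κ , k≗) = span-cong l (≋-sym (emb-combination₂ b κ k≗))
    (span-+ l (span-∙ l (ι (κ 0F)) b₀∈l) (span-∙ l (ι (κ 1F)) b₁∈l))

  -- The isomorphism between the induced geometry and the quadric over 𝔽₂.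

  private
    toPoint : (p : ∃[ p ] S p) → Σ (P₂.Point r) (P₂.Singular q)
    toPoint (p , k , c , c≉0 , qk , p≋) = P₂.point k (λ k≗0 → Point.nonzero p
      (λ j → trans (p≋ j) (trans (*-congˡ (emb-false e k≗0 j)) (zeroʳ c)))) , qk

    fromPoint : Σ (P₂.Point r) (P₂.Singular q) → ∃[ p ] S p
    fromPoint (P₂.point k k≢0 , qk) =
      point (emb e k) (emb-nonzero k≢0) , k , 1# , 0≉1 ∘ sym , qk , λ j → sym (*-identityˡ _)

    coordinates : ∃[ p ] S p → Fin r → Bool
    coordinates p = P₂.vec (proj₁ (toPoint p))

    coordinates-injective : ∀ {p p′ : ∃[ p ] S p} →
      (∀ j → coordinates p j ≡ coordinates p′ j) → proj₁ p ≈ₚ proj₁ p′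
    coordinates-injective {p , k , c , c≉0 , _ , p≋} {p′ , k′ , c′ , c′≉0 , _ , p′≋} k≗k′
      with unscale c′≉0 p′≋
    ... | a , a≉0 , ≋ap′ = c * a , *-nonzero c≉0 a≉0 , λ j → begin
      vec p j            ≈⟨ p≋ j ⟩
      c * emb e k j      ≈⟨ *-congˡ (trans (emb-cong e k≗k′ j) (≋ap′ j)) ⟩
      c * (a * vec p′ j) ≈⟨ *-assoc c a _ ⟨
      c * a * vec p′ j   ∎

    coordinates-cong : ∀ {p p′ : ∃[ p ] S p} → proj₁ p ≈ₚ proj₁ p′ →
      ∀ j → coordinates p j ≡ coordinates p′ j
    coordinates-cong {p , k , c , c≉0 , _ , p≋} {p′ , k′ , c′ , c′≉0 , _ , p′≋} (a , a≉0 , p≋ap′) =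
      scaled-injective k k′ c≉0 (*-nonzero a≉0 c′≉0) λ j → begin
        c * emb e k j          ≈⟨ p≋ j ⟨
        vec p j                ≈⟨ p≋ap′ j ⟩
        a * vec p′ j           ≈⟨ *-congˡ (p′≋ j) ⟩
        a * (c′ * emb e k′ j)  ≈⟨ *-assoc a c′ _ ⟨
        a * c′ * emb e k′ j    ∎

    span⇔ : ∀ (l : Fin 2 → V d) (p : ∃[ p ] S p) → Span l (vec (proj₁ p)) ⇔ Span l (emb e (coordinates p))
    span⇔ l (p , k , c , c≉0 , qk , p≋) = mk⇔
      (λ p∈l → let c′ , _ , ≋c′p = unscale c≉0 p≋ in
        span-cong l (≋-sym ≋c′p) (span-∙ l c′ p∈l))
      (λ k∈l → span-cong l (≋-sym p≋) (span-∙ l c k∈l))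

    -- The substance lies in passing from 𝔽 to 𝔽₂: by `span⇒span₂`, the 𝔽-line through two points of
    -- the subgeometry contains no further subgeometry points than their 𝔽₂-line does.
    incidence : ∀ (l : Fin 2 → V d) (b : Fin 2 → Fin r → Bool) → P₂.Independent b →
      Span l (emb e (b 0F)) → Span l (emb e (b 1F)) → ∀ p →
      Span l (vec (proj₁ p)) ⇔ P₂.Span b (coordinates p)
    incidence l b ind b₀∈l b₁∈l p = mk⇔
      (λ p∈l → span⇒span₂ b (independent⇒nonzero₀ b ind) (independent⇒nonzero₁ b ind)
        (independent⇒distinct b ind) {l} b₀∈l b₁∈l (Equivalence.to (span⇔ l p) p∈l))
      (λ k∈b → Equivalence.from (span⇔ l p) (span₂⇒span l b b₀∈l b₁∈l k∈b))

    unit₀ unit₁ : Fin 2 → Scalar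
    unit₀ 0F = 1#
    unit₀ 1F = 0#
    unit₁ 0F = 0#
    unit₁ 1F = 1#

    ∈span₀ : (b : Fin 2 → V d) → Span b (b 0F)
    ∈span₀ b = unit₀ , λ j → solve 2 (λ x y → x := con true :* x :+ (con false :* y :+ con false)) refl (b 0F j) (b 1F j)

    ∈span₁ : (b : Fin 2 → V d) → Span b (b 1F)
    ∈span₁ b = unit₁ , λ j → solve 2 (λ x y → y := con false :* x :+ (con true :* y :+ con false)) refl (b 0F j) (b 1F j)

    -- The two distinct points of `S` that come with a line of the induced geometry have independent
    -- coordinate vectors, which serve as basis of the 𝔽₂-line.
    lineTo : ∀ (l : Geometry.Line (induced f S)) → ∃[ m ]
      (∀ p → Span (SingularLine.basis (proj₁ l)) (vec (proj₁ p)) ⇔ P₂.Span (P₂.SingularLine.basis m) (coordinates p))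
    lineTo (l , p₀ , p₁ , S₀ , S₁ , p₀∈l , p₁∈l , p₀≉p₁) = m , incident
      where
      open SingularLine l using (basis)
      b : Fin 2 → Fin r → Bool
      b 0F = coordinates (p₀ , S₀)
      b 1F = coordinates (p₁ , S₁)
      b-independent : P₂.Independent b
      b-independent = pair-independent b
        (P₂.Point.nonzero (proj₁ (toPoint (p₀ , S₀)))) (P₂.Point.nonzero (proj₁ (toPoint (p₁ , S₁))))
        (λ b₀≗b₁ → p₀≉p₁ (coordinates-injective {p₀ , S₀} {p₁ , S₁} b₀≗b₁))
      b₀∈l : Span basis (emb e (b 0F))
      b₀∈l = Equivalence.to (span⇔ basis (p₀ , S₀)) p₀∈l
      b₁∈l : Span basis (emb e (b 1F))
      b₁∈l = Equivalence.to (span⇔ basis (p₁ , S₁)) p₁∈l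
      m : P₂.SingularLine q
      m = record
        { basis       = b
        ; independent = b-independent
        ; singular    = λ k k∈b → sι≈0⇒false (trans (sym (f≈ k))
            (SingularLine.singular l (emb e k) (span₂⇒span basis b b₀∈l b₁∈l k∈b)))
        }
      incident : ∀ p → Span basis (vec (proj₁ p)) ⇔ P₂.Span b (coordinates p)
      incident = incidence basis b b-independent b₀∈l b₁∈l

    -- The embedded basis vectors are singular, and orthogonal because `q` also vanishes on their
    -- sum, so they span a totally singular line over 𝔽. They are also the two points of `S`
    -- required on it.
    lineFrom : ∀ (m : P₂.SingularLine q) → Σ (Geometry.Line (induced f S)) λ l →
      ∀ p → Span (SingularLine.basis (proj₁ l)) (vec (proj₁ p)) ⇔
            P₂.Span (P₂.SingularLine.basis m) (coordinates p)
    lineFrom m = (l , p₀ , p₁ , proj₂ s₀ , proj₂ s₁ , ∈span₀ basis , ∈span₁ basis , p₀≉p₁) , incident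
      where
      open P₂.SingularLine m using () renaming (basis to b; independent to b-independent; singular to b-singular)
      κ : Bool → Bool → Fin 2 → Bool
      κ x y 0F = x
      κ x y 1F = y
      q-span : ∀ x y k → (∀ j → k j ≡ (x ∧ b 0F j) xor (y ∧ b 1F j)) → q k ≡ false
      q-span x y k k≗ = b-singular k (κ x y , λ j → ≡.trans (k≗ j)
        (≡.cong ((x ∧ b 0F j) xor_) (≡.sym (Bool.xor-identityʳ _))))
      q₀ : q (b 0F) ≡ false
      q₀ = q-span true false (b 0F) (λ j → ≡.sym (Bool.xor-identityʳ _))
      q₁ : q (b 1F) ≡ false
      q₁ = q-span false true (b 1F) (λ j → ≡.refl)
      s₀ s₁ : ∃[ p ] S p
      s₀ = fromPoint (P₂.point (b 0F) (independent⇒nonzero₀ b b-independent) , q₀)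
      s₁ = fromPoint (P₂.point (b 1F) (independent⇒nonzero₁ b b-independent) , q₁)
      p₀ p₁ : Point d
      p₀ = proj₁ s₀
      p₁ = proj₁ s₁
      p₀≉p₁ : ¬ (p₀ ≈ₚ p₁)
      p₀≉p₁ p₀≈p₁ = independent⇒distinct b b-independent (coordinates-cong {s₀} {s₁} p₀≈p₁)
      basis : Fin 2 → V d
      basis i = emb e (b i)
      vanish : ∀ {a} → a ≡ false → s * ι a ≈ 0#
      vanish a≡0 = trans (*-congˡ (ι-cong a≡0)) (zeroʳ s)
      polar₀₁ : polar f (basis 0F) (basis 1F) ≈ 0#
      polar₀₁ = trans (polar-emb q e f≈ (b 0F) (b 1F)) (vanish (≡.cong₂ _xor_
        (q-span true true _ (λ j → ≡.refl)) (≡.cong₂ _xor_ q₀ q₁)))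
      l : SingularLine f
      l = record
        { basis       = basis
        ; independent = λ k kb≋0 →
            let k₀≈0 , k₁≈0 = emb-independent b (independent⇒nonzero₀ b b-independent)
                  (independent⇒nonzero₁ b b-independent) (independent⇒distinct b b-independent)
                  (λ j → trans (sym (combination₂ basis k j)) (kb≋0 j))
            in λ { 0F → k₀≈0 ; 1F → k₁≈0 }
        ; singular    = totallySingular basis
            (λ { 0F → trans (f≈ (b 0F)) (vanish q₀) ; 1F → trans (f≈ (b 1F)) (vanish q₁) })
            λ { 0F 0F → polar-self (basis 0F) ; 0F 1F → polar₀₁
              ; 1F 0F → trans (polar-comm (basis 1F) (basis 0F)) polar₀₁ ; 1F 1F → polar-self (basis 1F) }
        }
      incident : ∀ p → Span basis (vec (proj₁ p)) ⇔ P₂.Span b (coordinates p)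
      incident = incidence basis b b-independent (∈span₀ basis) (∈span₁ basis)

  induced≅quadric : induced f S ≅ P₂.quadric q
  induced≅quadric = record
    { point↔ = record
      { to        = toPoint
      ; from      = fromPoint
      ; to-cong   = λ {p} {p′} p≈p′ → ≗⇒≈ₚ {p = proj₁ (toPoint p)} {proj₁ (toPoint p′)}
                      (coordinates-cong {p} {p′} p≈p′)
      ; from-cong = λ {k} {k′} k≈k′ → coordinates-injective {fromPoint k} {fromPoint k′}
                      (≈ₚ⇒≗ {p = proj₁ k} {proj₁ k′} k≈k′)
      ; inverse   =
          (λ {k} {p} p≈k → ≗⇒≈ₚ {p = proj₁ (toPoint p)} {proj₁ k} (coordinates-cong {p} {fromPoint k} p≈k))
        , (λ {p} {k} k≈p → coordinates-injective {fromPoint k} {p} (≈ₚ⇒≗ {p = proj₁ k} {proj₁ (toPoint p)} k≈p))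
      }
    ; line→ = lineTo
    ; line← = lineFrom
    }

  -- Minimality of the subgeometry among those over 𝔽₂ containing `S`.

  module _ (B′ : Frame d) (S⊆B′ : S ⊆ subgeometry F₂ B′) where
    open Frame B′ using () renaming (rank to r′; basis to e′; independent to independent′)
    private module E′ = IndependentFamily 𝔽 1+1≈0 e′ independent′

    -- Containment of `S` in the other subgeometry gives each singular vector a scale of its own;
    -- minimality requires a common one for the whole frame.
    Scale : Scalar → Pred (Fin r → Bool) 0ℓ
    Scale c k = ∃[ k′ ] emb e k ≋ c ∙ emb e′ k′

    bits : ∀ {n} {κ : Fin n → Scalar} → (∀ i → κ i ∈ F₂) → ∃[ k ] (∀ i → κ i ≈ ι (k i))
    bits {κ = κ} κ∈F₂ = (λ i → proj₁ (bit (κ∈F₂ i))) , λ i → proj₂ (bit (κ∈F₂ i))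
      where
      bit : ∀ {x} → x ∈ F₂ → ∃[ a ] x ≈ ι a
      bit (inj₁ x≈0) = false , x≈0
      bit (inj₂ x≈1) = true , x≈1

    scale : ∀ {k} → ¬ (∀ i → k i ≡ false) → q k ≡ false → ∃[ c ] ¬ (c ≈ 0#) × Scale c k
    scale {k} k≢0 qk
      with S⊆B′ {point (emb e k) (emb-nonzero k≢0)} (k , 1# , 0≉1 ∘ sym , qk , λ j → sym (*-identityˡ _))
    ... | κ , c , κ∈F₂ , c≉0 , k≋ = c , c≉0 , proj₁ (bits κ∈F₂) , λ j → trans (k≋ j)
      (*-congˡ (combination-cong {b = e′} (proj₂ (bits κ∈F₂)) (λ _ _ → refl) j))

    scale-resp : ∀ {c c′ k} → c ≈ c′ → Scale c k → Scale c′ k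
    scale-resp c≈c′ (k′ , eq) = k′ , λ j → trans (eq j) (*-congʳ c≈c′)

    -- The relation c k′ + b l′ = a m′ between 𝔽₂-vectors makes `c` and `b` multiples of `a` by
    -- elements of 𝔽₂. Being non-zero, both equal `a`.
    common-scale : ∀ {a b c k l} k′ l′ m′ → ¬ (c ≈ 0#) → ¬ (b ≈ 0#) →
      emb e k ≋ c ∙ emb e′ k′ → emb e l ≋ b ∙ emb e′ l′ → emb e (λ i → k i xor l i) ≋ a ∙ emb e′ m′ →
      ¬ (∀ i → k i ≡ false) → ¬ (∀ i → l i ≡ false) → ¬ (∀ i → k i ≡ l i) → b ≈ c
    common-scale {a} {b} {c} {k} {l} k′ l′ m′ c≉0 b≉0 k≋ l≋ k+l≋ k≢0 l≢0 k≢l =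
      equal (solve-F₂ k′ l′ m′ c b a (E′.emb-coordinates k′ l′ m′ sum≋) (≢0 k≢0 k≋) (≢0 l≢0 l≋) k′≢l′)
      where
      sum≋ : (c ∙ emb e′ k′) +ᵥ (b ∙ emb e′ l′) ≋ a ∙ emb e′ m′
      sum≋ j = trans (sym (+-cong (k≋ j) (l≋ j))) (trans (sym (emb-xor e k l j)) (k+l≋ j))
      ≢0 : ∀ {k k′ c} → ¬ (∀ i → k i ≡ false) → emb e k ≋ c ∙ emb e′ k′ → ¬ (∀ i → k′ i ≡ false)
      ≢0 {c = c} k≢0 k≋ k′≡0 = emb-nonzero k≢0 (λ j →
        trans (k≋ j) (trans (*-congˡ (emb-false e′ k′≡0 j)) (zeroʳ c)))
      k′≢l′ : ¬ (∀ i → k′ i ≡ l′ i)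
      k′≢l′ k′≡l′ = k≢l (scaled-injective k l b≉0 c≉0 λ j → begin
        b * emb e k j          ≈⟨ *-congˡ (k≋ j) ⟩
        b * (c * emb e′ k′ j)  ≈⟨ *-congˡ (*-congˡ (emb-cong e′ k′≡l′ j)) ⟩
        b * (c * emb e′ l′ j)  ≈⟨ solve 3 (λ b c x → b :* (c :* x) := c :* (b :* x)) refl b c _ ⟩
        c * (b * emb e′ l′ j)  ≈⟨ *-congˡ (l≋ j) ⟨
        c * emb e l j          ∎)
      unit : ∀ {x} β → ¬ (x ≈ 0#) → x ≈ a * ι β → x ≈ a
      unit true  x≉0 x≈ = trans x≈ (*-identityʳ a)
      unit false x≉0 x≈ = ⊥-elim (x≉0 (trans x≈ (zeroʳ a)))
      equal : (∃₂ λ γ β → c ≈ a * ι γ × b ≈ a * ι β) → b ≈ c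
      equal (γ , β , c≈ , b≈) = trans (unit β b≉0 b≈) (sym (unit γ c≉0 c≈))

    scale-step : ∀ {c k l} → ¬ (c ≈ 0#) → Scale c k → q l ≡ false → q (λ i → k i xor l i) ≡ false →
      ¬ (∀ i → k i ≡ false) → ¬ (∀ i → l i ≡ false) → ¬ (∀ i → k i ≡ l i) → Scale c l
    scale-step {c} {k} {l} c≉0 (k′ , k≋) ql qk+l k≢0 l≢0 k≢l =
      let b , b≉0 , l′ , l≋ = scale l≢0 ql
          _ , _ , m′ , k+l≋ = scale (k≢l ∘ λ eq i → xor≡false (k i) (l i) (eq i)) qk+l
      in scale-resp {k = l} (common-scale k′ l′ m′ c≉0 b≉0 k≋ l≋ k+l≋ k≢0 l≢0 k≢l) (l′ , l≋)

    -- A line carries the scale from one point to the next. Vectors of the same scale are closed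
    -- under addition, so frame vectors that are not singular can be reached as well.
    scale-generated : ∀ {g c} → ¬ (c ≈ 0#) → Scale c g → ∀ {k} → Generated q g k → Scale c k
    scale-generated c≉0 g∈ origin = g∈
    scale-generated c≉0 g∈ (step {k} {l} k∈ ((_ , ql , qk+l) , k≢0 , l≢0 , k≢l)) =
      scale-step {k = k} {l} c≉0 (scale-generated c≉0 g∈ k∈) ql qk+l k≢0 l≢0 k≢l
    scale-generated {c = c} c≉0 g∈ (add {k} {l} k∈ l∈)
      with scale-generated c≉0 g∈ k∈ | scale-generated c≉0 g∈ l∈
    ... | k′ , k≋ | l′ , l≋ = (λ i → k′ i xor l′ i) , λ j → begin
      emb e (λ i → k i xor l i) j          ≈⟨ emb-xor e k l j ⟩
      emb e k j + emb e l j                ≈⟨ +-cong (k≋ j) (l≋ j) ⟩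
      c * emb e′ k′ j + c * emb e′ l′ j    ≈⟨ distribˡ c _ _ ⟨
      c * (emb e′ k′ j + emb e′ l′ j)      ≈⟨ *-congˡ (emb-xor e′ k′ l′ j) ⟨
      c * emb e′ (λ i → k′ i xor l′ i) j   ∎
    scale-generated c≉0 g∈ (≗-resp k∈ k≗l) with scale-generated c≉0 g∈ k∈
    ... | k′ , k≋ = k′ , λ j → trans (sym (emb-cong e k≗l j)) (k≋ j)

    -- With one scale `c` for the whole frame, every 𝔽₂-combination of `e` is `c` times an
    -- 𝔽₂-combination of `e′`, with coordinates changed by the matrix `M`.
    least-if-generated : ∀ {g} → ¬ (∀ i → g i ≡ false) → q g ≡ false → (∀ i → Generated q g (δ i)) →
      subgeometry F₂ B ⊆ subgeometry F₂ B′
    least-if-generated {g} g≢0 qg generated {p} (κ , a , κ∈F₂ , a≉0 , p≋) with scale g≢0 qg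
    ... | c , c≉0 , g∈ = ι ∘ k′ , a * c , (λ i → ι∈F₂ (k′ i)) , *-nonzero a≉0 c≉0 , λ j → begin
      vec p j                                ≈⟨ p≋ j ⟩
      a * combination κ e j                  ≈⟨ *-congˡ (combination-cong (proj₂ (bits κ∈F₂)) basis≋ j) ⟩
      a * emb (λ i → c ∙ emb e′ (M i)) k j   ≈⟨ *-congˡ (emb-∙ c (λ i → emb e′ (M i)) k j) ⟩
      a * (c * emb (λ i → emb e′ (M i)) k j) ≈⟨ *-congˡ (*-congˡ (emb-emb e′ M k j)) ⟩
      a * (c * emb e′ k′ j)                  ≈⟨ *-assoc a c _ ⟨
      a * c * emb e′ k′ j                    ∎
      where
      k : Fin r → Bool
      k = proj₁ (bits κ∈F₂)
      M : Fin r → Fin r′ → Bool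
      M i = proj₁ (scale-generated c≉0 g∈ (generated i))
      k′ : Fin r′ → Bool
      k′ = k · M
      basis≋ : ∀ i → e i ≋ c ∙ emb e′ (M i)
      basis≋ i j = trans (sym (emb-δ e i j)) (proj₂ (scale-generated c≉0 g∈ (generated i)) j)

  -- Recovering a configuration from a model as the part of `S` outside the hyperplane.

  module _ (H₀ : Hyperplane d) (n₀ : Point d) (perp : IsPerp f n₀ H₀)
           {m : ℕ} (model : Model m q) (n₀≋ : vec n₀ ≋ emb e (Model.ν model))
           (x : Fin m → Fin 2 → Point d) (affine : ∀ i a → Affine f H₀ (x i a))
           (x≋ : ∀ i a → ∃[ c ] ¬ (c ≈ 0#) × vec (x i a) ≋ c ∙ emb e (Model.Y model i a))
           {X : Pred (Point d) 0ℓ} (X≐x : X ≐ (λ p → ∃[ i ] ∃[ a ] p ≈ₚ x i a)) where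
    open IsPerp perp
    open Model model

    H₀-∙ : ∀ {c u v} → ¬ (c ≈ 0#) → u ≋ c ∙ v → u ∈ ⟦ H₀ ⟧ₕ → v ∈ ⟦ H₀ ⟧ₕ
    H₀-∙ {c} {u} {v} c≉0 u≋ u∈ = proj₁ n₀⊥≐H₀ (cancelˡ c≉0 (begin
      c * polar f (vec n₀) v    ≈⟨ polar-∙ʳ c (vec n₀) v ⟨
      polar f (vec n₀) (c ∙ v)  ≈⟨ polar-cong (λ _ → refl) u≋ ⟨
      polar f (vec n₀) u        ≈⟨ proj₂ n₀⊥≐H₀ u∈ ⟩
      0#                        ∎))

    ∈H₀ : ∀ {k c v} → v ≋ c ∙ emb e k → polarForm q ν k ≡ false → v ∈ ⟦ H₀ ⟧ₕ
    ∈H₀ {k} {c} {v} v≋ qνk = proj₁ n₀⊥≐H₀ (begin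
      polar f (vec n₀) v                ≈⟨ polar-cong n₀≋ v≋ ⟩
      polar f (emb e ν) (c ∙ emb e k)   ≈⟨ polar-∙ʳ c (emb e ν) (emb e k) ⟩
      c * polar f (emb e ν) (emb e k)   ≈⟨ *-congˡ (trans (polar-emb q e f≈ ν k) (*-congˡ (ι-cong qνk))) ⟩
      c * (s * 0#)                      ≈⟨ solve 2 (λ c s → c :* (s :* con false) := con false) refl c s ⟩
      0#                                ∎)

    arises : ArisesFrom f H₀ n₀ (P₂.quadric q) X
    arises = record
      { S          = S
      ; S-resp     = λ {p} {p′} → S-respects {p} {p′}
      ; S⊆Q        = λ {p} → S⊆Singular {p}
      ; F₂-subgeom = F₂-isFieldOf
      ; Q[S]≅𝒬     = induced≅quadric
      ; n₀∈⟨S⟩     = B , record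
        { contains = λ {p} → S⊆subgeometry {p}
        ; least    = λ B′ S⊆B′ {p} → least-if-generated B′ (λ {p} → S⊆B′ {p}) g≢0 qg generated {p}
        } , ι ∘ ν , 1# , (λ i → ι∈F₂ (ν i)) , 0≉1 ∘ sym , λ j → trans (n₀≋ j) (sym (*-identityˡ _))
      ; X≐S∖H₀     = X⊆ , ⊆X
      }
      where
      x∈S : ∀ i a → S (x i a)
      x∈S i a = let c , c≉0 , eq = x≋ i a in Y i a , c , c≉0 , q-false c≉0 eq (proj₁ (affine i a)) , eq
      X⊆ : X ⊆ (λ p → p ∈ S × vec p ∉ ⟦ H₀ ⟧ₕ)
      X⊆ {p} p∈X with proj₁ X≐x p∈X
      ... | i , a , p≈x = S-respects {x i a} {p} (≈ₚ-sym {p = p} {x i a} p≈x) (x∈S i a)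
        , proj₂ (affine i a) ∘ H₀-∙ (proj₁ (proj₂ p≈x)) (proj₂ (proj₂ p≈x))
      ⊆X : (λ p → p ∈ S × vec p ∉ ⟦ H₀ ⟧ₕ) ⊆ X
      ⊆X {p} (p∈S@(k , c , c≉0 , qk , p≋) , p∉H₀) =
        -- A point outside `H₀` is not orthogonal to `n₀`, whose coordinates are `ν`; this is the
        -- second premise of `cover`.
        let i , a , k≗Y = cover k qk (¬-not (p∉H₀ ∘ ∈H₀ {k} p≋))
        in proj₂ X≐x (i , a , coordinates-injective {p , p∈S} {x i a , x∈S i a} k≗Y)

-- The vectors of a centric configuration and their Gram matrix.

module CentricConfiguration (𝔽 : Field) (1+1≈0 : HasCharacteristicTwo 𝔽) {d : ℕ}
                            (f : Projective.V 𝔽 d → Projective.Scalar 𝔽)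
                            (isQ : Projective.IsQuadraticForm 𝔽 f)
                            (H₀ : Projective.Hyperplane 𝔽 d)
                            (nonDegenerate : Projective.NonDegenerateOn 𝔽 (Projective.⟦_⟧ₕ 𝔽 H₀) f)
                            (n₀ : Projective.Point 𝔽 d) (perp : Projective.IsPerp 𝔽 f n₀ H₀)
                            {m : ℕ} {X : Pred (Projective.Point 𝔽 d) 0ℓ}
                            (config : Projective.IsCentricConfiguration 𝔽 f H₀ m n₀ X) where
  open Projective 𝔽
  open Combinations 𝔽 1+1≈0
  open Field 𝔽 hiding (zero)
  open FieldProperties 𝔽
  open CharacteristicTwo 𝔽 1+1≈0
  open QuadraticForm 𝔽 1+1≈0 f isQ
  open SetoidReasoning setoid
  open IsCentricConfiguration config
  open IsPerp perp

  x̄ : Fin m → Fin 2 → Point d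
  x̄ i a = proj₁ (x i a)

  n : V d
  n = vec n₀

  s : Scalar
  s = f n

  -- The polar form alternates, so `n` lies in its own perp `H₀`, and it is orthogonal to all of
  -- `H₀`. If it were singular, `f` would be degenerate there.
  s≉0 : ¬ (s ≈ 0#)
  s≉0 s≈0 = Point.nonzero n₀
    (nonDegenerate n (proj₁ n₀⊥≐H₀ (polar-self n)) (λ w w∈H₀ → proj₂ n₀⊥≐H₀ w∈H₀) s≈0)

  α : Fin m → Fin 2 → Scalar
  α i = proj₁ (center i)

  u : Fin m → Fin 2 → V d
  u i a = α i a ∙ vec (x̄ i a)

  n≋ : ∀ i → n ≋ u i 0F +ᵥ u i 1F
  n≋ i j = trans (proj₂ (center i) j) (+-congˡ (+-identityʳ _))

  f-u : ∀ i a → f (u i a) ≈ 0#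
  f-u i a = trans (homogen (α i a) (vec (x̄ i a)))
    (trans (*-congˡ (proj₁ (proj₂ (x i a)))) (zeroʳ _))

  polar-u₀u₁ : ∀ i → polar f (u i 0F) (u i 1F) ≈ s
  polar-u₀u₁ i = begin
    polar f (u i 0F) (u i 1F)                             ≈⟨ solve 1 (λ x → x := con false :+ con false :+ x) refl _ ⟩
    0# + 0# + polar f (u i 0F) (u i 1F)                   ≈⟨ +-congʳ (+-cong (f-u i 0F) (f-u i 1F)) ⟨
    f (u i 0F) + f (u i 1F) + polar f (u i 0F) (u i 1F)   ≈⟨ f-+ (u i 0F) (u i 1F) ⟨
    f (u i 0F +ᵥ u i 1F)                                  ≈⟨ f-cong (n≋ i) ⟨
    s                                                     ∎

  -- The line joining the two points is totally singular and contains the sum of their vectors.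
  polar-adjacent : ∀ {i j} → i ≢ j → polar f (vec (x̄ i 0F)) (vec (x̄ j 1F)) ≈ 0#
  polar-adjacent {i} {j} i≢j = collinear (Equivalence.from (adjacent i j 0F 1F) (i≢j , λ ()))
    where
    p q : V d
    p = vec (x̄ i 0F)
    q = vec (x̄ j 1F)
    collinear : Geometry.Adjacent (X̂ f H₀) (x i 0F) (x j 1F) → polar f p q ≈ 0#
    collinear (_ , (l , _) , p∈l , q∈l) = begin
      f (p +ᵥ q) - f p - f q  ≈⟨ +-cong (+-cong (SingularLine.singular l (p +ᵥ q) (span-+ (SingularLine.basis l) p∈l q∈l))
                                   (-‿cong (proj₁ (proj₂ (x i 0F))))) (-‿cong (proj₁ (proj₂ (x j 1F)))) ⟩
      0# - 0# - 0#            ≈⟨ solve 0 (con false :- con false :- con false := con false) refl ⟩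
      0#                      ∎

  polar-n : ∀ i → polar f (u i 0F) n ≈ s
  polar-n i = begin
    polar f (u i 0F) n                                      ≈⟨ polar-cong (λ _ → refl) (n≋ i) ⟩
    polar f (u i 0F) (u i 0F +ᵥ u i 1F)                     ≈⟨ polar-+ʳ (u i 0F) (u i 0F) (u i 1F) ⟩
    polar f (u i 0F) (u i 0F) + polar f (u i 0F) (u i 1F)   ≈⟨ +-cong (polar-self (u i 0F)) (polar-u₀u₁ i) ⟩
    0# + s                                                  ≈⟨ +-identityˡ s ⟩
    s                                                       ∎

  -- Since `u i 0F` is orthogonal to `u j 1F`, its product with `u j 0F` equals that with `n`, the
  -- sum of the two.
  polar-u : ∀ {i j} → i ≢ j → polar f (u i 0F) (u j 0F) ≈ s
  polar-u {i} {j} i≢j = begin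
    polar f (u i 0F) (u j 0F)                               ≈⟨ +-identityʳ _ ⟨
    polar f (u i 0F) (u j 0F) + 0#                          ≈⟨ +-congˡ (trans (polar-∙ (α i 0F) _ (u j 1F)) (trans (*-congˡ
                                                                 (trans (polar-∙ʳ (α j 1F) _ _) (trans (*-congˡ (polar-adjacent i≢j)) (zeroʳ _)))) (zeroʳ _))) ⟨
    polar f (u i 0F) (u j 0F) + polar f (u i 0F) (u j 1F)   ≈⟨ polar-+ʳ (u i 0F) (u j 0F) (u j 1F) ⟨
    polar f (u i 0F) (u j 0F +ᵥ u j 1F)                     ≈⟨ polar-cong (λ _ → refl) (n≋ j) ⟨
    polar f (u i 0F) n                                      ≈⟨ polar-n i ⟩
    s                                                       ∎

  U : Fin (suc m) → V d
  U zero    = n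
  U (suc i) = u i 0F

  U-gram : HasGram s U configurationGram
  U-gram = record { f-diagonal = f-diagonal ; polar-off = polar-off }
    where
    f-diagonal : ∀ i → f (U i) ≈ s * ι (configurationGram i i)
    f-diagonal zero    = sym (*-identityʳ s)
    f-diagonal (suc i) with i Fin.≟ i
    ... | yes _   = trans (f-u i 0F) (sym (zeroʳ s))
    ... | no  i≢i = ⊥-elim (i≢i ≡.refl)
    polar-off : ∀ i j → i ≢ j → polar f (U i) (U j) ≈ s * ι (configurationGram i j)
    polar-off zero    zero    0≢0 = ⊥-elim (0≢0 ≡.refl)
    polar-off zero    (suc j) _   = trans (polar-comm n (u j 0F)) (trans (polar-n j) (sym (*-identityʳ s)))
    polar-off (suc i) zero    _   = trans (polar-n i) (sym (*-identityʳ s))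
    polar-off (suc i) (suc j) i≢j with i Fin.≟ j
    ... | yes i≡j = ⊥-elim (i≢j (≡.cong suc i≡j))
    ... | no  i≢j = trans (polar-u i≢j) (sym (*-identityʳ s))

  f-U : Represents s (gramForm configurationGram) U
  f-U = f-emb U-gram

  -- A vanishing coefficient would make the product of `u i 0F` and `u i 1F` zero, but it is `s`.
  α≉0 : ∀ i a → ¬ (α i a ≈ 0#)
  α≉0 i a α≈0 = s≉0 (trans (sym (polar-u₀u₁ i)) (vanish a α≈0))
    where
    vanish : ∀ a → α i a ≈ 0# → polar f (u i 0F) (u i 1F) ≈ 0#
    vanish 0F α≈0 = polar-0ˡ (u i 1F) (λ j → trans (*-congʳ α≈0) (zeroˡ _))
    vanish 1F α≈0 = trans (polar-comm _ _) (polar-0ˡ (u i 0F) (λ j → trans (*-congʳ α≈0) (zeroˡ _)))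

  u≋ : ∀ i a → u i a ≋ emb U (pointVector i a)
  u≋ i 0F j = sym (emb-δ U (suc i) j)
  u≋ i 1F j = begin
    u i 1F j                                     ≈⟨ solve 2 (λ x y → y := x :+ y :+ x) refl (u i 0F j) (u i 1F j) ⟩
    u i 0F j + u i 1F j + u i 0F j               ≈⟨ +-cong (n≋ i j) refl ⟨
    n j + u i 0F j                               ≈⟨ +-cong (emb-δ U zero j) (emb-δ U (suc i) j) ⟨
    emb U (δ zero) j + emb U (δ (suc i)) j       ≈⟨ emb-xor U (δ zero) (δ (suc i)) j ⟨
    emb U (pointVector i 1F) j                   ∎

  x̄≋ : ∀ i a → ∃[ c ] ¬ (c ≈ 0#) × vec (x̄ i a) ≋ c ∙ emb U (pointVector i a)
  x̄≋ i a =
    let c , c≉0 , x≋ = unscale {u = u i a} {v = vec (x̄ i a)} (α≉0 i a) (λ _ → refl)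
    in c , c≉0 , λ j → trans (x≋ j) (*-congˡ (u≋ i a j))

  polar-U : ∀ k l → polar f (emb U k) (emb U l) ≈ s * ι (configurationPolar k l)
  polar-U = polar-emb (gramForm configurationGram) U f-U

  -- The vector `w` is dual to the `j`-th one: the polar product of the relation with `emb U w`
  -- leaves only `s * κ j`.
  coordinate-zero : ∀ {r} (E : Fin r → Fin (suc m) → Bool) κ j w →
    (∀ i → configurationPolar (E i) w ≡ δ j i) →
    combination κ (λ i → emb U (E i)) ≋ 0ᵥ → κ j ≈ 0#
  coordinate-zero E κ j w dual κe≋0 = cancelˡ s≉0 (begin
    s * κ j                                               ≈⟨ *-comm s (κ j) ⟩
    -- The one-dimensional case of `emb-δ` expands a scalar into a sum against a Kronecker delta.
    κ j * s                                               ≈⟨ emb-δ {d = 1} (λ i _ → κ i * s) j 0F ⟨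
    sum (λ i → ι (δ j i) * (κ i * s))                     ≈⟨ sum-cong-≋ term ⟩
    sum (λ i → κ i * polar f (emb U (E i)) (emb U w))     ≈⟨ polar-combination κ (λ i → emb U (E i)) (emb U w) ⟨
    polar f (combination κ (λ i → emb U (E i))) (emb U w) ≈⟨ polar-0ˡ _ κe≋0 ⟩
    0#                                                    ∎)
    where
    open Sum semiring
    term : ∀ i → ι (δ j i) * (κ i * s) ≈ κ i * polar f (emb U (E i)) (emb U w)
    term i = begin
      ι (δ j i) * (κ i * s)                               ≈⟨ solve 3 (λ x y z → x :* (y :* z) := y :* (z :* x)) refl _ (κ i) s ⟩
      κ i * (s * ι (δ j i))                               ≈⟨ *-congˡ (trans (polar-U (E i) w) (*-congˡ (ι-cong (dual i)))) ⟨
      κ i * polar f (emb U (E i)) (emb U w)               ∎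

  module _ {r : ℕ} {q : (Fin r → Bool) → Bool} (model : Model m q) where
    open Model model

    e : Fin r → V d
    e i = emb U (E i)

    f-e : Represents s q e
    f-e k = begin
      f (emb e k)                                    ≈⟨ f-cong (emb-emb U E k) ⟩
      f (emb U (k · E))                              ≈⟨ f-U (k · E) ⟩
      s * ι (gramForm configurationGram (k · E))     ≈⟨ *-congˡ (ι-cong (gram≡q k)) ⟩
      s * ι (q k)                                    ∎

    -- The points are compared as vectors, not by their coordinates in `U`, because for the dodecade
    -- the vectors `U` are dependent.
    module _ (independent : Independent e)
             (Y≋ : ∀ i a → emb U (Y i a · E) ≋ emb U (pointVector i a)) where
      private
        frame : Frame d
        frame = record { basis = e ; independent = independent }

        n₀≋ : n ≋ emb e ν
        n₀≋ j = trans (sym (emb-δ U zero j)) (trans (sym (emb-cong U ν·E j)) (sym (emb-emb U E ν j)))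

        x≋ : ∀ i a → ∃[ c ] ¬ (c ≈ 0#) × vec (x̄ i a) ≋ c ∙ emb e (Y i a)
        x≋ i a =
          let c , c≉0 , x≋ = x̄≋ i a
          in c , c≉0 , λ j →
             trans (x≋ j) (*-congˡ (trans (sym (Y≋ i a j)) (sym (emb-emb U E (Y i a) j))))

      configuration-arises : ArisesFrom f H₀ n₀ (Projective.quadric 𝔽₂ q) X
      configuration-arises = BooleanFrame.arises 𝔽 1+1≈0 f isQ frame s≉0 q f-e
        H₀ n₀ perp model n₀≋ x̄ (λ i a → proj₂ (x i a)) x≋ X≐x

-- Explicit models of the three configurations, checked by finite computation.

module FiniteModels where

  private variable
    m r : ℕ

  -- The search runs over vectors, which are built from their entries, whereas functions are
  -- determined by their values only up to pointwise equality.
  ∀Vec? : ∀ r {P : Vec Bool r → Set} → (∀ v → Dec (P v)) → Dec (∀ v → P v)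
  ∀Vec? zero    P? = map′ (λ { p [] → p }) (λ p → p []) (P? [])
  ∀Vec? (suc r) P? = map′ (λ { (p , _) (true ∷ v) → p v ; (_ , p) (false ∷ v) → p v })
    (λ p → (λ v → p (true ∷ v)) , λ v → p (false ∷ v))
    (∀Vec? r (λ v → P? (true ∷ v)) ×-dec ∀Vec? r (λ v → P? (false ∷ v)))

  infix 4 _≗?_
  _≗?_ : (k l : Fin r → Bool) → Dec (∀ i → k i ≡ l i)
  k ≗? l = Fin.all? λ i → k i Bool.≟ l i

  collinear? : (q : (Fin r → Bool) → Bool) → ∀ k l → Dec (Collinear q k l)
  collinear? q k l = ((q k Bool.≟ false) ×-dec (q l Bool.≟ false) ×-dec (q (λ i → k i xor l i) Bool.≟ false))
    ×-dec (¬? (k ≗? λ _ → false) ×-dec ¬? (l ≗? λ _ → false) ×-dec ¬? (k ≗? l))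

  -- The implicit argument is filled by evaluating the decision procedure, so a path along 𝔽₂-lines
  -- is given by its points alone.
  move : {q : (Fin r → Bool) → Bool} {g k : Fin r → Bool} → Generated q g k → ∀ l →
         {True (collinear? q k l)} → Generated q g l
  move k∈ l {c} = step k∈ (toWitness c)

  equal : {q : (Fin r → Bool) → Bool} {g k : Fin r → Bool} → Generated q g k → ∀ l →
          {True (k ≗? l)} → Generated q g l
  equal k∈ l {k≗l} = ≗-resp k∈ (toWitness k≗l)

  cover? : (q : (Fin r → Bool) → Bool) (ν : Fin r → Bool) (Y : Fin m → Fin 2 → Fin r → Bool) →
    Dec (∀ (v : Vec Bool r) → let k = lookup v in
      q k ≡ false → polarForm q ν k ≡ true → ∃₂ λ i a → ∀ j → k j ≡ Y i a j)
  cover? q ν Y = ∀Vec? _ λ v → (q (lookup v) Bool.≟ false) →-dec (polarForm q ν (lookup v) Bool.≟ true)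
    →-dec Fin.any? λ i → Fin.any? λ a → lookup v ≗? Y i a

  gram? : (E : Fin r → Fin (suc m) → Bool) (q : (Fin r → Bool) → Bool) →
    Dec (∀ (v : Vec Bool r) → gramForm configurationGram (lookup v · E) ≡ q (lookup v))
  gram? E q = ∀Vec? _ λ v → gramForm configurationGram (lookup v · E) Bool.≟ q (lookup v)

  -- These are the certificates for `coordinate-zero`; `σ` selects the vectors that have a dual,
  -- since one in the radical has none.
  dual? : ∀ {n} (E : Fin r → Fin (suc m) → Bool) (E* : Fin n → Fin (suc m) → Bool) (σ : Fin n → Fin r) →
    Dec (∀ i j → configurationPolar (E j) (E* i) ≡ δ (σ i) j)
  dual? E E* σ = Fin.all? λ i → (λ j → configurationPolar (E j) (E* i)) ≗? δ (σ i)

  -- The index `j` is a variable here, so the lookup in the table does not reduce by itself.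
  tabulated : (k : Fin r → Bool) {Y : Fin m → Fin 2 → Fin r → Bool} →
    (∃₂ λ i a → ∀ j → lookup (tabulate k) j ≡ Y i a j) → ∃₂ λ i a → ∀ j → k j ≡ Y i a j
  tabulated k (i , a , k≗) = i , a , λ j → ≡.trans (≡.sym (lookup∘tabulate k j)) (k≗ j)

  pattern O = false
  pattern I = true

  rows : ∀ {n} → Vec (Vec Bool n) r → Fin r → Fin n → Bool
  rows M i j = lookup (lookup M i) j

  -- The second point of each pair is the third point on the 𝔽₂-line through the first one and the
  -- center `ν`.
  points : Vec (Vec Bool r) m → (Fin r → Bool) → Fin m → Fin 2 → Fin r → Bool
  points M ν i 0F = rows M i
  points M ν i 1F = λ j → rows M i j xor ν j

  q₃ : (Fin 4 → Bool) → Bool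
  q₃ x = (x 0F ∧ x 1F) xor (x 2F ∧ x 3F)

  q₄ : (Fin 5 → Bool) → Bool
  q₄ x = (x 0F ∧ x 0F) xor (x 1F ∧ x 2F) xor (x 3F ∧ x 4F)

  q₆ : (Fin 6 → Bool) → Bool
  q₆ x = ((x 0F ∧ x 0F) xor (x 0F ∧ x 1F) xor (x 1F ∧ x 1F)) xor (x 2F ∧ x 3F) xor (x 4F ∧ x 5F)

  -- The polar form of q₃ pairs the i-th unit vector with the partner₃ i-th one only; likewise for q₆.
  partner₃ : Fin 4 → Fin 4
  partner₃ = lookup (1F ∷ 0F ∷ 3F ∷ 2F ∷ [])

  partner₆ : Fin 6 → Fin 6
  partner₆ = lookup (1F ∷ 0F ∷ 3F ∷ 2F ∷ 5F ∷ 4F ∷ [])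

  hexagon : Model 3 q₃
  hexagon = record
    { E         = E
    -- For a numeral length, all lookups in `tabulate k` occur at closed indices and reduce to
    -- values of `k`.
    ; gram≡q    = λ k → from-yes (gram? E q₃) (tabulate k)
    ; ν         = ν
    ; ν·E       = from-yes (ν · E ≗? δ zero)
    ; g≢0       = from-no (δ {4} 0F ≗? λ _ → false)
    ; qg        = ≡.refl
    ; generated = λ { 0F → origin ; 1F → d₁ ; 2F → d₂ ; 3F → move d₁ (δ 3F) }
    ; Y         = Y
    ; cover     = λ k qk νk → tabulated k (from-yes (cover? q₃ ν Y) (tabulate k) qk νk)
    }
    where
    -- The rows u₁, n₀ + u₁ form a hyperbolic pair, and n₀ + u₁ + u₂, n₀ + u₁ + u₃ form a second one
    -- orthogonal to it.
    E : Fin 4 → Fin 4 → Bool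
    E = rows ((O ∷ I ∷ O ∷ O ∷ [])
            ∷ (I ∷ I ∷ O ∷ O ∷ [])
            ∷ (I ∷ I ∷ I ∷ O ∷ [])
            ∷ (I ∷ I ∷ O ∷ I ∷ []) ∷ [])
    ν : Fin 4 → Bool
    ν = lookup (I ∷ I ∷ O ∷ O ∷ [])
    Y : Fin 3 → Fin 2 → Fin 4 → Bool
    Y = points ((I ∷ O ∷ O ∷ O ∷ [])
              ∷ (O ∷ I ∷ I ∷ O ∷ [])
              ∷ (O ∷ I ∷ O ∷ I ∷ []) ∷ []) ν
    -- The members of a hyperbolic pair are not collinear, so the path passes through the other
    -- pair.
    d₂ : Generated q₃ (δ 0F) (δ 2F)
    d₂ = move origin (δ 2F)
    d₁ : Generated q₃ (δ 0F) (δ 1F)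
    d₁ = move d₂ (δ 1F)

  cube : Model 4 q₄
  cube = record
    { E         = E
    ; gram≡q    = λ k → from-yes (gram? E q₄) (tabulate k)
    ; ν         = ν
    ; ν·E       = from-yes (ν · E ≗? δ zero)
    ; g≢0       = from-no (δ {5} 1F ≗? λ _ → false)
    ; qg        = ≡.refl
    ; generated = λ { 0F → equal (add (add w origin) d₂) (δ 0F)
                    ; 1F → origin ; 2F → d₂ ; 3F → d₃ ; 4F → d₄ }
    ; Y         = Y
    ; cover     = λ k qk νk → tabulated k (from-yes (cover? q₄ ν Y) (tabulate k) qk νk)
    }
    where
    -- The first row, the sum of n₀, u₁, ..., u₄, is non-singular and orthogonal to all of them: it
    -- is the nucleus of Q(4,2). The other rows are the hyperbolic pairs of the hexagon.
    E : Fin 5 → Fin 5 → Bool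
    E = rows ((I ∷ I ∷ I ∷ I ∷ I ∷ [])
            ∷ (O ∷ I ∷ O ∷ O ∷ O ∷ [])
            ∷ (I ∷ I ∷ O ∷ O ∷ O ∷ [])
            ∷ (I ∷ I ∷ I ∷ O ∷ O ∷ [])
            ∷ (I ∷ I ∷ O ∷ I ∷ O ∷ []) ∷ [])
    ν : Fin 5 → Bool
    ν = lookup (O ∷ I ∷ I ∷ O ∷ O ∷ [])
    Y : Fin 4 → Fin 2 → Fin 5 → Bool
    Y = points ((O ∷ I ∷ O ∷ O ∷ O ∷ [])
              ∷ (O ∷ O ∷ I ∷ I ∷ O ∷ [])
              ∷ (O ∷ O ∷ I ∷ O ∷ I ∷ [])
              ∷ (I ∷ O ∷ I ∷ I ∷ I ∷ []) ∷ []) ν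
    d₃ : Generated q₄ (δ 1F) (δ 3F)
    d₃ = move origin (δ 3F)
    d₂ : Generated q₄ (δ 1F) (δ 2F)
    d₂ = move d₃ (δ 2F)
    d₄ : Generated q₄ (δ 1F) (δ 4F)
    d₄ = move d₂ (δ 4F)
    -- The nucleus is on no singular line. Its sum with the first hyperbolic pair is singular, and
    -- adding that pair again gives the nucleus.
    w : Generated q₄ (δ 1F) (lookup (I ∷ I ∷ I ∷ O ∷ O ∷ []))
    w = move d₄ _

  dodecade : Model 6 q₆
  dodecade = record
    { E         = E
    ; gram≡q    = λ k → from-yes (gram? E q₆) (tabulate k)
    ; ν         = ν
    ; ν·E       = from-yes (ν · E ≗? δ zero)
    ; g≢0       = from-no (δ {6} 2F ≗? λ _ → false)
    ; qg        = ≡.refl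
    ; generated = λ { 0F → equal (add (add w₀ origin) d₃) (δ 0F)
                    ; 1F → equal (add (add w₁ origin) d₃) (δ 1F)
                    ; 2F → origin ; 3F → d₃ ; 4F → d₄ ; 5F → d₅ }
    ; Y         = Y
    ; cover     = λ k qk νk → tabulated k (from-yes (cover? q₆ ν Y) (tabulate k) qk νk)
    }
    where
    -- The first two rows span an anisotropic plane orthogonal to the hyperbolic pairs of the
    -- hexagon. The vector u₆ does not occur, since it is the sum of the other six.
    E : Fin 6 → Fin 7 → Bool
    E = rows ((I ∷ I ∷ I ∷ I ∷ I ∷ O ∷ O ∷ [])
            ∷ (I ∷ I ∷ I ∷ I ∷ O ∷ I ∷ O ∷ [])
            ∷ (O ∷ I ∷ O ∷ O ∷ O ∷ O ∷ O ∷ [])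
            ∷ (I ∷ I ∷ O ∷ O ∷ O ∷ O ∷ O ∷ [])
            ∷ (I ∷ I ∷ I ∷ O ∷ O ∷ O ∷ O ∷ [])
            ∷ (I ∷ I ∷ O ∷ I ∷ O ∷ O ∷ O ∷ []) ∷ [])
    ν : Fin 6 → Bool
    ν = lookup (O ∷ O ∷ I ∷ I ∷ O ∷ O ∷ [])
    Y : Fin 6 → Fin 2 → Fin 6 → Bool
    Y = points ((O ∷ O ∷ I ∷ O ∷ O ∷ O ∷ [])
              ∷ (O ∷ O ∷ O ∷ I ∷ I ∷ O ∷ [])
              ∷ (O ∷ O ∷ O ∷ I ∷ O ∷ I ∷ [])
              ∷ (I ∷ O ∷ O ∷ I ∷ I ∷ I ∷ [])
              ∷ (O ∷ I ∷ O ∷ I ∷ I ∷ I ∷ [])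
              ∷ (I ∷ I ∷ O ∷ I ∷ I ∷ I ∷ []) ∷ []) ν
    d₄ : Generated q₆ (δ 2F) (δ 4F)
    d₄ = move origin (δ 4F)
    d₃ : Generated q₆ (δ 2F) (δ 3F)
    d₃ = move d₄ (δ 3F)
    d₅ : Generated q₆ (δ 2F) (δ 5F)
    d₅ = move d₃ (δ 5F)
    w₀ : Generated q₆ (δ 2F) (lookup (I ∷ O ∷ I ∷ I ∷ O ∷ O ∷ []))
    w₀ = move d₄ _
    w₁ : Generated q₆ (δ 2F) (lookup (O ∷ I ∷ I ∷ I ∷ O ∷ O ∷ []))
    w₁ = move d₄ _

open FiniteModels

-- Hexagons, cubes and dodecades: independence of the frames and conclusion.

module ClassicalConfigurations (𝔽 : Field) (1+1≈0 : HasCharacteristicTwo 𝔽)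
                               (_≟_ : Decidable (Field._≈_ 𝔽)) {d : ℕ}
                               (f : Projective.V 𝔽 d → Projective.Scalar 𝔽)
                               (isQ : Projective.IsQuadraticForm 𝔽 f)
                               (H₀ : Projective.Hyperplane 𝔽 d)
                               (nonDegenerate : Projective.NonDegenerateOn 𝔽 (Projective.⟦_⟧ₕ 𝔽 H₀) f)
                               (n₀ : Projective.Point 𝔽 d) (perp : Projective.IsPerp 𝔽 f n₀ H₀)
                               {X : Pred (Projective.Point 𝔽 d) 0ℓ} where
  open Projective 𝔽
  open Field 𝔽 hiding (zero)
  open FieldProperties 𝔽
  open CharacteristicTwo 𝔽 1+1≈0
  open Combinations 𝔽 1+1≈0
  open QuadraticForm 𝔽 1+1≈0 f isQ
  open SetoidReasoning setoid

  nonzero⇒zero-scalar : ∀ {c} {v : V d} → ¬ (v ≋ 0ᵥ) → c ∙ v ≋ 0ᵥ → c ≈ 0#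
  nonzero⇒zero-scalar {c} v≢0 cv≋0 with c ≟ 0#
  ... | yes c≈0 = c≈0
  ... | no  c≉0 = ⊥-elim (v≢0 (λ j → cancelˡ c≉0 (cv≋0 j)))

  hexagon-arises : IsCentricConfiguration f H₀ 3 n₀ X → ArisesFrom f H₀ n₀ Q⁺[3,2] X
  hexagon-arises config = configuration-arises hexagon independent
    (λ i a → emb-cong U (from-yes (Fin.all? λ i → Fin.all? λ a → (Y i a · E) ≗? pointVector i a) i a))
    where
    open CentricConfiguration 𝔽 1+1≈0 f isQ H₀ nonDegenerate n₀ perp config
    open Model hexagon
    dual : ∀ i j → configurationPolar (E j) (E (partner₃ i)) ≡ δ i j
    dual = from-yes (dual? E (E ∘ partner₃) id)
    independent : Independent (λ i → emb U (E i))
    independent κ κe≋0 i = coordinate-zero E κ i (E (partner₃ i)) (dual i) κe≋0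

  cube-arises : IsCentricConfiguration f H₀ 4 n₀ X → ArisesFrom f H₀ n₀ Q[4,2] X
  cube-arises config = configuration-arises cube independent
    (λ i a → emb-cong U (from-yes (Fin.all? λ i → Fin.all? λ a → (Y i a · E) ≗? pointVector i a) i a))
    where
    open CentricConfiguration 𝔽 1+1≈0 f isQ H₀ nonDegenerate n₀ perp config
    open Model cube
    dual : ∀ i j → configurationPolar (E j) (E (suc (partner₃ i))) ≡ δ (suc i) j
    dual = from-yes (dual? E (E ∘ suc ∘ partner₃) suc)
    -- The nucleus is orthogonal to the whole frame and has no dual vector; it is non-zero because
    -- `f` takes the value `s` there.
    E₀≢0 : ¬ (emb U (E 0F) ≋ 0ᵥ)
    E₀≢0 E₀≋0 = s≉0 (trans (sym (*-identityʳ s)) (trans (sym (f-U (E 0F))) (f-zero E₀≋0)))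
    independent : Independent (λ i → emb U (E i))
    independent κ κe≋0 = λ { 0F → κ₀≈0 ; (suc i) → κ≈0 i }
      where
      κ≈0 : ∀ i → κ (suc i) ≈ 0#
      κ≈0 i = coordinate-zero E κ (suc i) (E (suc (partner₃ i))) (dual i) κe≋0
      κ₀≈0 : κ 0F ≈ 0#
      κ₀≈0 = nonzero⇒zero-scalar E₀≢0 λ j → begin
        κ 0F * emb U (E 0F) j              ≈⟨ +-identityʳ _ ⟨
        κ 0F * emb U (E 0F) j + 0#         ≈⟨ +-congˡ (combination-zero (λ i → emb U (E (suc i))) κ≈0 j) ⟨
        combination κ (λ i → emb U (E i)) j ≈⟨ κe≋0 j ⟩
        0#                                 ∎

  module _ (witt : HasWittIndex f 2) (config : IsCentricConfiguration f H₀ 6 n₀ X) where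
    open CentricConfiguration 𝔽 1+1≈0 f isQ H₀ nonDegenerate n₀ perp config
    open Model dodecade

    z : V d
    z = emb U (λ _ → true)

    -- z is singular and orthogonal to every vector of U, so it would extend a totally singular line.
    z≋0 : z ≋ 0ᵥ
    z≋0 j with z j ≟ 0#
    ... | yes zj≈0 = zj≈0
    -- The Witt index gives `3 ≤ 2`, which is `2 < 2` by definition.
    ... | no  zj≉0 = ⊥-elim (ℕ.<-irrefl ≡.refl (proj₂ witt 3 (b , independent , singular)))
      where
      -- The first two rows, u₁ and n₀ + u₁ + u₂, span a totally singular line, and the third is
      -- `z`. The rows of `W*` are dual to the first two and orthogonal to `z`.
      W : Fin 3 → Fin 7 → Bool
      W = rows ((O ∷ I ∷ O ∷ O ∷ O ∷ O ∷ O ∷ [])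
              ∷ (I ∷ I ∷ I ∷ O ∷ O ∷ O ∷ O ∷ [])
              ∷ (I ∷ I ∷ I ∷ I ∷ I ∷ I ∷ I ∷ []) ∷ [])
      W* : Fin 2 → Fin 7 → Bool
      W* = rows ((I ∷ I ∷ O ∷ O ∷ O ∷ O ∷ O ∷ [])
               ∷ (I ∷ I ∷ O ∷ I ∷ O ∷ O ∷ O ∷ []) ∷ [])
      b : Fin 3 → V d
      b i = emb U (W i)
      singular : TotallySingular f b
      singular = totallySingular b
        (λ i → trans (f-U (W i)) (trans (*-congˡ (ι-cong
          (from-yes ((λ i → gramForm configurationGram (W i)) ≗? λ _ → false) i))) (zeroʳ s)))
        (λ i j → trans (polar-U (W i) (W j)) (trans (*-congˡ (ι-cong
          (from-yes (Fin.all? λ i → configurationPolar (W i) ∘ W ≗? λ _ → false) i j))) (zeroʳ s)))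
      dual : ∀ i l → configurationPolar (W l) (W* i) ≡ δ (Fin.inject₁ i) l
      dual = from-yes (dual? W W* Fin.inject₁)
      b₂≢0 : ¬ (b 2F ≋ 0ᵥ)
      b₂≢0 b₂≋0 = zj≉0 (trans (emb-cong U (from-yes ((λ _ → true) ≗? W 2F)) j) (b₂≋0 j))
      independent : Independent b
      independent κ κb≋0 = λ { 0F → κ≈0 0F ; 1F → κ≈0 1F ; 2F → κ₂≈0 }
        where
        κ≈0 : ∀ i → κ (Fin.inject₁ i) ≈ 0#
        κ≈0 i = coordinate-zero W κ (Fin.inject₁ i) (W* i) (dual i) κb≋0
        κ₂≈0 : κ 2F ≈ 0#
        κ₂≈0 = nonzero⇒zero-scalar b₂≢0 λ j → begin
          κ 2F * b 2F j         ≈⟨ solve 3 (λ x y z → z := con false :* x :+ (con false :* y :+ (z :+ con false))) refl (b 0F j) (b 1F j) _ ⟩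
          0# * b 0F j + (0# * b 1F j + (κ 2F * b 2F j + 0#))
                                ≈⟨ +-cong (*-congʳ (κ≈0 0F)) (+-congʳ (*-congʳ (κ≈0 1F))) ⟨
          combination κ b j     ≈⟨ κb≋0 j ⟩
          0#                    ∎

    dodecade-arises : ArisesFrom f H₀ n₀ Q⁻[5,2] X
    dodecade-arises = configuration-arises dodecade independent Y≋
      where
      dual : ∀ i j → configurationPolar (E j) (E (partner₆ i)) ≡ δ i j
      dual = from-yes (dual? E (E ∘ partner₆) id)
      independent : Independent (λ i → emb U (E i))
      independent κ κe≋0 i = coordinate-zero E κ i (E (partner₆ i)) (dual i) κe≋0
      -- The frame omits u₆, so the last pair of points is reproduced only up to the sum `z` of all
      -- seven vectors, which vanishes.
      Y·E : ∀ i a j → (Y i a · E) j ≡ pointVector i a j xor does (i Fin.≟ 5F)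
      Y·E = from-yes (Fin.all? λ i → Fin.all? λ a → (Y i a · E) ≗? λ j → pointVector i a j xor does (i Fin.≟ 5F))
      constant≋0 : ∀ c → emb U (λ _ → c) ≋ 0ᵥ
      constant≋0 true  = z≋0
      constant≋0 false = emb-false U (λ _ → ≡.refl)
      Y≋ : ∀ i a → emb U (Y i a · E) ≋ emb U (pointVector i a)
      Y≋ i a j = begin
        emb U (Y i a · E) j                                         ≈⟨ emb-cong U (Y·E i a) j ⟩
        emb U (λ j → pointVector i a j xor does (i Fin.≟ 5F)) j     ≈⟨ emb-xor U (pointVector i a) (λ _ → does (i Fin.≟ 5F)) j ⟩
        emb U (pointVector i a) j + emb U (λ _ → does (i Fin.≟ 5F)) j ≈⟨ +-congˡ (constant≋0 (does (i Fin.≟ 5F)) j) ⟩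
        emb U (pointVector i a) j + 0#                              ≈⟨ +-identityʳ _ ⟩
        emb U (pointVector i a) j                                   ∎

theorem4 :
    (n : ℕ) (𝔽 : Field) → HasOrder 𝔽 (2 ^ n) →
    let open Projective 𝔽 in
    (f : V 6 → Scalar) → IsQuadraticForm f → NonDegenerate f → HasWittIndex f 2 →
    (H₀ : Hyperplane 6) → NonDegenerateOn ⟦ H₀ ⟧ₕ f →
    (n₀ : Point 6) → IsPerp f n₀ H₀ →
    ((ℋ : Pred (Point 6) 0ℓ) → IsCentricConfiguration f H₀ 3 n₀ ℋ →
      ArisesFrom f H₀ n₀ Q⁺[3,2] ℋ)
    × ((C : Pred (Point 6) 0ℓ) → IsCentricConfiguration f H₀ 4 n₀ C →
      ArisesFrom f H₀ n₀ Q[4,2] C)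
    × ((D : Pred (Point 6) 0ℓ) → IsCentricConfiguration f H₀ 6 n₀ D →
      ArisesFrom f H₀ n₀ Q⁻[5,2] D)
theorem4 n 𝔽 order f isQ _ witt H₀ nonDegenerate n₀ perp =
  (λ _ → hexagon-arises) , (λ _ → cube-arises) , (λ _ → dodecade-arises witt)
  where
  open FiniteField 𝔽 order using (_≟_; order×1≈0; 2^n×1≈0⇒1+1≈0)
  open ClassicalConfigurations 𝔽 (2^n×1≈0⇒1+1≈0 n order×1≈0) _≟_ f isQ H₀ nonDegenerate n₀ perp
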